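{- Let $X$ be an $n$-element set, $n\ge1$, let $0\le k\le n$, and let $\pi_X\in\Pi_l(X)$ be the labelled set partition into singletons of which exactly $k$ are labelled. Let $P_0(n,k)$ be the number of $\pi\in\Pi_l(X,\pi_X)$ with $\lambda(\pi)\ne0$. Then \[ P_0(n,0)=\sum_{j=0}^{n-1}\binom{n}{j}B(n-j)=B(n+1)-1,\qquad P_0(n,k)=\sum_{j=0}^{n-k}\binom{n-k}{j}B(n-j)\ \text{ for }k\ge1, \] where $B(m)$ denotes the $m$-th Bell number.
   Context: For a finite set $X$ and a symbol $l\notin X$, a labelled set partition of $X$ is $\pi=\{B_1\cup L_1,\dots,B_k\cup L_k\}$ with $\{B_1,\dots,B_k\}$ a set partition of $X$ and $L_i\in\{\emptyset,\{l\}\}$ (labelled block iff $L_i=\{l\}$). $\Pi_l(X)$ is the set of these, ordered by $\sigma\le\pi$ iff every block of $\sigma$ (including $l$ if present) is contained in a block of $\pi$; $\mu$ is its Möbius function. $m(\pi)=1$ if $\pi$ has exactly one labelled block, else $0$. $\Pi_l(X,\pi_X)=\{\pi\in\Pi_l(X):\pi\ge\pi_X,\ \pi\text{ has at least one labelled block}\}$. For $\pi\in\Pi_l(X,\pi_X)$, $\lambda(\pi)=\sum_{\sigma\in\Pi_l(X,\pi_X),\sigma\ge\pi}\mu(\pi,\sigma)m(\sigma)$. -}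

module Defs where

open import Data.Bool using (Bool; true; false; _∧_; _∨_; not; if_then_else_)
open import Data.Nat using (ℕ; zero; suc; _+_; _*_; _∸_)
open import Data.Nat.Combinatorics using (_C_)
open import Data.Fin using (Fin; toℕ)
import Data.Fin as F
open import Data.Integer using (ℤ; 0ℤ; 1ℤ; -_) renaming (_+_ to _+ℤ_; _*_ to _*ℤ_)
import Data.Integer as Z
open import Data.List using (List; []; _∷_; [_]; map; concatMap; length; filterᵇ; allFin; foldr)
open import Data.Bool.ListAction using (and)
open import Data.Vec using (Vec; []; _∷_; lookup; tabulate)
open import Data.Product using (_×_; _,_; proj₁; proj₂)
open import Relation.Nullary using (does)
open import Function using (id)

stirling2 : ℕ → ℕ → ℕ
stirling2 zero    zero    = 1
stirling2 zero    (suc k) = 0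
stirling2 (suc n) zero    = 0
stirling2 (suc n) (suc k) = suc k * stirling2 n (suc k) + stirling2 n k

sumTo : ℕ → (ℕ → ℕ) → ℕ
sumTo zero    f = f 0
sumTo (suc m) f = sumTo m f + f (suc m)

bell : ℕ → ℕ
bell m = sumTo m (stirling2 m)

all : {A : Set} → (A → Bool) → List A → Bool
all p xs = and (map p xs)

allVecs : {A : Set} → List A → (n : ℕ) → List (Vec A n)
allVecs xs zero    = [ [] ]
allVecs xs (suc n) = concatMap (λ x → map (x ∷_) (allVecs xs n)) xs

_⇒ᵇ_ : Bool → Bool → Bool
a ⇒ᵇ b = not a ∨ b

sumℤ : List ℤ → ℤ
sumℤ = foldr _+ℤ_ 0ℤ

countᵇ : {A : Set} → (A → Bool) → List A → ℕ
countᵇ p xs = length (filterᵇ p xs)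

-- Möbius function of a finite poset given by an enumeration P of its
-- elements, a Boolean order relation and Boolean equality:
--   μ(x,x) = 1,  μ(x,y) = - Σ_{x ≤ z < y} μ(x,z) if x < y,  0 otherwise.
-- The recursion is run with fuel = |P|, which is enough since any
-- strict chain has at most |P| elements.

module Möbius {A : Set} (P : List A) (_≤ᵇ_ : A → A → Bool) (_≡ᵇ_ : A → A → Bool) where

  μ-fuel : ℕ → A → A → ℤ
  μ-fuel zero    x y = 0ℤ
  μ-fuel (suc f) x y =
    if x ≡ᵇ y then 1ℤ
    else if x ≤ᵇ y
      then - sumℤ (map (μ-fuel f x)
                       (filterᵇ (λ z → (x ≤ᵇ z) ∧ ((z ≤ᵇ y) ∧ not (z ≡ᵇ y))) P))
      else 0ℤ

  μ : A → A → ℤ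
  μ = μ-fuel (length P)

-- Labelled set partitions of X = Fin n.
-- A labelled set partition is encoded canonically by a pair (f , lab):
--  * f i is the least element of the block containing i
--    (valid iff f i ≤ i and f (f i) = f i; the blocks are the fibres of f),
--  * lab i = true iff the block of i is labelled (must be constant on
--    blocks: lab i = lab (f i)).
-- Valid pairs are in bijection with labelled set partitions of Fin n.

LP : ℕ → Set
LP n = Vec (Fin n) n × Vec Bool n

_≟ᶠ_ : {n : ℕ} → Fin n → Fin n → Bool
a ≟ᶠ b = does (a F.≟ b)

boolEq : Bool → Bool → Bool
boolEq true  b = b
boolEq false b = not b

module _ {n : ℕ} where

  blk : LP n → Fin n → Fin n
  blk π i = lookup (proj₁ π) i

  lab : LP n → Fin n → Bool
  lab π i = lookup (proj₂ π) i

  valid : LP n → Bool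
  valid π = all (λ i → does (toℕ (blk π i) Data.Nat.≤? toℕ i)
                     ∧ ((blk π (blk π i) ≟ᶠ blk π i)
                     ∧ boolEq (lab π i) (lab π (blk π i))))
                (allFin n)

  _≡LP_ : LP n → LP n → Bool
  σ ≡LP π = all (λ i → (blk σ i ≟ᶠ blk π i) ∧ boolEq (lab σ i) (lab π i)) (allFin n)

  _≤LP_ : LP n → LP n → Bool
  σ ≤LP π = all (λ i → all (λ j → (blk σ i ≟ᶠ blk σ j) ⇒ᵇ (blk π i ≟ᶠ blk π j)) (allFin n)
                       ∧ (lab σ i ⇒ᵇ lab π i))
                (allFin n)

  -- number of labelled blocks (blocks counted by their least element)
  numLabelled : LP n → ℕ
  numLabelled π = countᵇ (λ i → (blk π i ≟ᶠ i) ∧ lab π i) (allFin n)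

  hasLabelled : LP n → Bool
  hasLabelled π = all (λ i → not (lab π i)) (allFin n) ⇒ᵇ false

  mfun : LP n → ℤ
  mfun π = if does (numLabelled π Data.Nat.≟ 1) then 1ℤ else 0ℤ

Πl : (n : ℕ) → List (LP n)
Πl n = filterᵇ valid
         (concatMap (λ f → map (f ,_) (allVecs (true ∷ false ∷ []) n))
                    (allVecs (allFin n) n))

μl : {n : ℕ} → LP n → LP n → ℤ
μl {n} = Möbius.μ (Πl n) _≤LP_ _≡LP_

πX : {n : ℕ} → Vec Bool n → LP n
πX {n} L = tabulate id , L

ΠlX : {n : ℕ} → Vec Bool n → List (LP n)
ΠlX {n} L = filterᵇ (λ π → (πX L ≤LP π) ∧ hasLabelled π) (Πl n)

lambda : {n : ℕ} → Vec Bool n → LP n → ℤ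
lambda L π = sumℤ (map (λ σ → μl π σ *ℤ mfun σ) (filterᵇ (λ σ → π ≤LP σ) (ΠlX L)))

P0 : {n : ℕ} → Vec Bool n → ℕ
P0 L = countᵇ (λ π → not (does (lambda L π Z.≟ 0ℤ))) (ΠlX L)

numTrue : {n : ℕ} → Vec Bool n → ℕ
numTrue []          = 0
numTrue (true ∷ v)  = suc (numTrue v)
numTrue (false ∷ v) = numTrue v

{-# OPTIONS --safe #-}
module Submission where

-- Let T w (b) = b w(b) + w(b+1) and F = T + 1. Inserting the elements of X one
-- by one, the sum of w(number of labelled blocks) over all σ ≥ π with at most
-- one unlabelled block is (F^f T^t w)(0), where π has t labelled and f
-- unlabelled blocks. For w(b) = (-1)^(b-1) (b-1)! this is 1 if t = 1 and 0 if
-- t ≥ 2, that is, m(π); so by Möbius inversion λ(π) = (-1)^(b-1) (b-1)! if π has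
-- b labelled and at most one unlabelled block, and λ(π) = 0 otherwise. Hence
-- P₀(n,k) is the sum for π = π_X and w(b) = [b ≥ 1]. It is evaluated by
-- expanding (T + 1)^f, since (T^m 1)(0) = B(m).

open import Defs
open import Algebra.Properties.CommutativeSemigroup using (interchange)
open import Data.Bool using (Bool; true; false; _∧_; not; if_then_else_)
open import Data.Bool.Properties using (T?; T-≡; ∧-zeroʳ)
open import Data.Empty using (⊥-elim)
open import Data.Fin using (Fin; zero; suc; toℕ; fromℕ<)
import Data.Fin as Fin
import Data.Fin.Properties as Fin
open import Data.Integer using (ℤ; 0ℤ; 1ℤ; -_)
  renaming (+_ to pos; _+_ to _+ℤ_; _*_ to _*ℤ_)
import Data.Integer as ℤ
import Data.Integer.Properties as ℤ
import Data.Integer.Tactic.RingSolver as ℤ-Solver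
open import Data.List
  using (List; []; _∷_; [_]; _++_; map; concatMap; length; filterᵇ; allFin; tabulate)
open import Data.List.Membership.Propositional using (_∈_; lose; find)
open import Data.List.Membership.Propositional.Properties
  using (∈-filter⁺; ∈-filter⁻; ∈-concatMap⁺; ∈-concatMap⁻; ∈-map⁺; ∈-map⁻; ∈-allFin)
open import Data.List.Membership.Propositional.Properties.WithK using (unique∧set⇒bag)
open import Data.List.Properties using (length-tabulate)
open import Data.List.Relation.Binary.BagAndSetEquality using (∼bag⇒↭)
open import Data.List.Relation.Binary.Permutation.Propositional
  using (_↭_; refl; prep; swap; trans)
open import Data.List.Relation.Unary.All using ([]; _∷_)
import Data.List.Relation.Unary.All as All
open import Data.List.Relation.Unary.AllPairs using ([]; _∷_)
open import Data.List.Relation.Unary.Any using (here; there)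
open import Data.List.Relation.Unary.Unique.Propositional using (Unique)
import Data.List.Relation.Unary.Unique.Propositional.Properties as Unique
open import Data.Nat using (ℕ; zero; suc; _+_; _*_; _∸_; _≤_; _<_; z≤n; s≤s)
open import Data.Nat.Combinatorics using (_C_; nCk+nC[k+1]≡[n+1]C[k+1]; k>n⇒nCk≡0; nCn≡1)
open import Data.Nat.GeneralisedArithmetic using (iterate)
open import Data.Nat.Induction using (<-rec)
import Data.Nat.Properties as ℕ
open import Data.Nat.Tactic.RingSolver using (solve-∀)
open import Data.Product using (_×_; _,_; proj₁; proj₂)
open import Data.Product.Properties using (,-injectiveˡ; ,-injectiveʳ)
open import Data.Sum using (_⊎_; inj₁; inj₂)
open import Data.Unit using (⊤; tt)
open import Data.Vec using (Vec; []; _∷_; lookup)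
import Data.Vec as Vec
import Data.Vec.Properties as Vec
open import Function using (_∘_; id; mk⇔; Equivalence)
open import Relation.Nullary using (Dec; yes; no; does; contradiction)
open import Relation.Nullary.Decidable using (dec-true; dec-false)
open import Relation.Binary.PropositionalEquality
  using (_≡_; _≢_; _≗_; refl; sym; cong; cong₂; subst; module ≡-Reasoning)
import Relation.Binary.PropositionalEquality as ≡

-- Encode w by the exponential generating function Σ w(b) y^b / b!. Then T is (1 + y) d/dy, and
-- evaluation at b = 0 is evaluation at y = 0. The weight (-1)^(b-1) (b-1)! is log(1 + y): T sends
-- it to the constant series 1, which T kills and F = T + 1 fixes. This is where the candidate for λ
-- comes from. The weight constantly 1 is e^y; under y = e^x - 1 the operator T is d/dx, so (T^m
-- 1)(0) is the m-th derivative of exp(e^x - 1) at x = 0, the Bell number. The obstacle is that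
-- `Πl n` is a filtered list of vectors, in which no element-by-element growth is visible. The upper
-- set of π is therefore listed a second time, by codes that grow one element at a time, and the two
-- lists are shown to be permutations of each other.

private variable
  A B : Set
  n : ℕ

-- Finite sums of integers

∈-filterᵇ⁻ : (p : A → Bool) {x : A} {xs : List A} → x ∈ filterᵇ p xs → x ∈ xs × p x ≡ true
∈-filterᵇ⁻ p x∈ with x∈xs , px ← ∈-filter⁻ (T? ∘ p) x∈ = x∈xs , Equivalence.to T-≡ px

∈-filterᵇ⁺ : (p : A → Bool) {x : A} {xs : List A} → x ∈ xs → p x ≡ true → x ∈ filterᵇ p xs
∈-filterᵇ⁺ p x∈ px = ∈-filter⁺ (T? ∘ p) x∈ (Equivalence.from T-≡ px)

Σ : List A → (A → ℤ) → ℤ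
Σ xs f = sumℤ (map f xs)

Σ-cong : (xs : List A) {f g : A → ℤ} → (∀ {x} → x ∈ xs → f x ≡ g x) → Σ xs f ≡ Σ xs g
Σ-cong []       f≡g = refl
Σ-cong (x ∷ xs) f≡g = cong₂ _+ℤ_ (f≡g (here refl)) (Σ-cong xs (f≡g ∘ there))

Σ-0 : (xs : List A) → Σ xs (λ _ → 0ℤ) ≡ 0ℤ
Σ-0 []       = refl
Σ-0 (x ∷ xs) = ≡.trans (ℤ.+-identityˡ _) (Σ-0 xs)

Σ-+ : (xs : List A) (f g : A → ℤ) → Σ xs (λ x → f x +ℤ g x) ≡ Σ xs f +ℤ Σ xs g
Σ-+ []       f g = refl
Σ-+ (x ∷ xs) f g = ≡.trans (cong (f x +ℤ g x +ℤ_) (Σ-+ xs f g))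
                           (interchange ℤ.+-commutativeSemigroup (f x) (g x) (Σ xs f) (Σ xs g))

Σ-*ʳ : (xs : List A) (f : A → ℤ) (c : ℤ) → Σ xs (λ x → f x *ℤ c) ≡ Σ xs f *ℤ c
Σ-*ʳ []       f c = refl
Σ-*ʳ (x ∷ xs) f c = ≡.trans (cong (f x *ℤ c +ℤ_) (Σ-*ʳ xs f c))
                            (sym (ℤ.*-distribʳ-+ c (f x) (Σ xs f)))

Σ-*ˡ : (xs : List A) (f : A → ℤ) (c : ℤ) → Σ xs (λ x → c *ℤ f x) ≡ c *ℤ Σ xs f
Σ-*ˡ xs f c = begin
  Σ xs (λ x → c *ℤ f x)  ≡⟨ Σ-cong xs (λ {x} _ → ℤ.*-comm c (f x)) ⟩
  Σ xs (λ x → f x *ℤ c)  ≡⟨ Σ-*ʳ xs f c ⟩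
  Σ xs f *ℤ c            ≡⟨ ℤ.*-comm (Σ xs f) c ⟩
  c *ℤ Σ xs f            ∎
  where open ≡-Reasoning

Σ-swap : (xs : List A) (ys : List B) (f : A → B → ℤ) →
         Σ xs (λ x → Σ ys (f x)) ≡ Σ ys (λ y → Σ xs (λ x → f x y))
Σ-swap []       ys f = sym (Σ-0 ys)
Σ-swap (x ∷ xs) ys f = ≡.trans (cong (Σ ys (f x) +ℤ_) (Σ-swap xs ys f))
                               (sym (Σ-+ ys (f x) (λ y → Σ xs (λ x → f x y))))

Σ-filterᵇ : (p : A → Bool) (f : A → ℤ) (xs : List A) →
            Σ (filterᵇ p xs) f ≡ Σ xs (λ x → if p x then f x else 0ℤ)
Σ-filterᵇ p f []       = refl
Σ-filterᵇ p f (x ∷ xs) with p x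
... | true  = cong (f x +ℤ_) (Σ-filterᵇ p f xs)
... | false = ≡.trans (Σ-filterᵇ p f xs) (sym (ℤ.+-identityˡ _))

Σ-map : (h : A → B) (f : B → ℤ) (xs : List A) → Σ (map h xs) f ≡ Σ xs (f ∘ h)
Σ-map h f []       = refl
Σ-map h f (x ∷ xs) = cong (f (h x) +ℤ_) (Σ-map h f xs)

Σ-++ : (f : A → ℤ) (xs ys : List A) → Σ (xs ++ ys) f ≡ Σ xs f +ℤ Σ ys f
Σ-++ f []       ys = sym (ℤ.+-identityˡ _)
Σ-++ f (x ∷ xs) ys = ≡.trans (cong (f x +ℤ_) (Σ-++ f xs ys)) (sym (ℤ.+-assoc (f x) _ _))

Σ-concatMap : (h : A → List B) (f : B → ℤ) (xs : List A) →
              Σ (concatMap h xs) f ≡ Σ xs (λ x → Σ (h x) f)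
Σ-concatMap h f []       = refl
Σ-concatMap h f (x ∷ xs) =
  ≡.trans (Σ-++ f (h x) (concatMap h xs)) (cong (Σ (h x) f +ℤ_) (Σ-concatMap h f xs))

Σ-↭ : (f : A → ℤ) {xs ys : List A} → xs ↭ ys → Σ xs f ≡ Σ ys f
Σ-↭ f refl         = refl
Σ-↭ f (prep x p)   = cong (f x +ℤ_) (Σ-↭ f p)
Σ-↭ f (trans p q)  = ≡.trans (Σ-↭ f p) (Σ-↭ f q)
Σ-↭ f {x ∷ y ∷ xs} {y ∷ x ∷ ys} (swap x y p) = begin
  f x +ℤ (f y +ℤ Σ xs f)  ≡⟨ cong (λ s → f x +ℤ (f y +ℤ s)) (Σ-↭ f p) ⟩
  f x +ℤ (f y +ℤ Σ ys f)  ≡⟨ ℤ.+-assoc (f x) (f y) _ ⟨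
  (f x +ℤ f y) +ℤ Σ ys f  ≡⟨ cong (_+ℤ Σ ys f) (ℤ.+-comm (f x) (f y)) ⟩
  (f y +ℤ f x) +ℤ Σ ys f  ≡⟨ ℤ.+-assoc (f y) (f x) _ ⟩
  f y +ℤ (f x +ℤ Σ ys f)  ∎
  where open ≡-Reasoning

Σ-single : {xs : List A} (f : A → ℤ) {y : A} → Unique xs → y ∈ xs →
           (∀ {z} → z ∈ xs → z ≢ y → f z ≡ 0ℤ) → Σ xs f ≡ f y
Σ-single {xs = x ∷ xs} f (x∉ ∷ u) (here refl) f0 = begin
  f x +ℤ Σ xs f           ≡⟨ cong (f x +ℤ_) (Σ-cong xs λ z∈ → f0 (there z∈) (All.lookup x∉ z∈ ∘ sym)) ⟩
  f x +ℤ Σ xs (λ _ → 0ℤ)  ≡⟨ cong (f x +ℤ_) (Σ-0 xs) ⟩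
  f x +ℤ 0ℤ               ≡⟨ ℤ.+-identityʳ (f x) ⟩
  f x                     ∎
  where open ≡-Reasoning
Σ-single {xs = x ∷ xs} f (x∉ ∷ u) (there y∈) f0 =
  ≡.trans (cong₂ _+ℤ_ (f0 (here refl) (All.lookup x∉ y∈)) (Σ-single f u y∈ (f0 ∘ there)))
          (ℤ.+-identityˡ _)

-- Monotonicity of counting

countᵇ-mono : (p q : A → Bool) (xs : List A) → (∀ x → p x ≡ true → q x ≡ true) →
              countᵇ p xs ≤ countᵇ q xs
countᵇ-mono p q []       p⇒q = z≤n
countᵇ-mono p q (x ∷ xs) p⇒q with p x in px | q x in qx
... | true  | true  = s≤s (countᵇ-mono p q xs p⇒q)
... | true  | false = contradiction (≡.trans (sym qx) (p⇒q x px)) λ ()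
... | false | true  = ℕ.m≤n⇒m≤1+n (countᵇ-mono p q xs p⇒q)
... | false | false = countᵇ-mono p q xs p⇒q

countᵇ-mono-< : (p q : A → Bool) (xs : List A) → (∀ x → p x ≡ true → q x ≡ true) →
                ∀ {w} → w ∈ xs → p w ≡ false → q w ≡ true → countᵇ p xs < countᵇ q xs
countᵇ-mono-< p q (x ∷ xs) p⇒q (here refl) pw qw rewrite pw | qw = s≤s (countᵇ-mono p q xs p⇒q)
countᵇ-mono-< p q (x ∷ xs) p⇒q (there w∈) pw qw with p x in px | q x in qx
... | true  | true  = s≤s (countᵇ-mono-< p q xs p⇒q w∈ pw qw)
... | true  | false = contradiction (≡.trans (sym qx) (p⇒q x px)) λ ()
... | false | true  = ℕ.m≤n⇒m≤1+n (countᵇ-mono-< p q xs p⇒q w∈ pw qw)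
... | false | false = countᵇ-mono-< p q xs p⇒q w∈ pw qw

countᵇ≤length : (p : A → Bool) (xs : List A) → countᵇ p xs ≤ length xs
countᵇ≤length p []       = z≤n
countᵇ≤length p (x ∷ xs) with p x
... | true  = s≤s (countᵇ≤length p xs)
... | false = ℕ.m≤n⇒m≤1+n (countᵇ≤length p xs)

∧-true⁻ : ∀ {a b} → a ∧ b ≡ true → a ≡ true × b ≡ true
∧-true⁻ {true} {true} refl = refl , refl

-- Möbius inversion

module Inversion {A : Set} (P : List A) (_≤ᵇ_ _≡ᵇ_ : A → A → Bool)
  (≡ᵇ⇒≡ : ∀ {x y} → x ≡ᵇ y ≡ true → x ≡ y) (≡ᵇ-refl : ∀ x → x ≡ᵇ x ≡ true)
  (≤ᵇ-refl : ∀ x → x ≤ᵇ x ≡ true)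
  (≤ᵇ-trans : ∀ {x y z} → x ≤ᵇ y ≡ true → y ≤ᵇ z ≡ true → x ≤ᵇ z ≡ true)
  (≤ᵇ-antisym : ∀ {x y} → x ∈ P → y ∈ P → x ≤ᵇ y ≡ true → y ≤ᵇ x ≡ true → x ≡ y)
  (P! : Unique P) where

  open Möbius P _≤ᵇ_ _≡ᵇ_

  -- Half-open, as in the recursion for `μ`: only the top y is excluded, while z = x is allowed.
  strictlyBetween : A → A → A → Bool
  strictlyBetween x y z = (x ≤ᵇ z) ∧ ((z ≤ᵇ y) ∧ not (z ≡ᵇ y))

  -- Measures the fuel that `μ-fuel` needs at y: it is at most `length P` and drops strictly at each
  -- recursive call.
  rank : A → ℕ
  rank y = countᵇ (_≤ᵇ y) P

  rank-pos : ∀ {y} → y ∈ P → 0 < rank y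
  rank-pos {y} y∈ = ℕ.≤-<-trans z≤n
    (countᵇ-mono-< (λ _ → false) (_≤ᵇ y) P (λ _ ()) y∈ refl (≤ᵇ-refl y))

  strict⇒≢ : ∀ {y z} → not (z ≡ᵇ y) ≡ true → z ≢ y
  strict⇒≢ {y} n refl with y ≡ᵇ y | ≡ᵇ-refl y
  strict⇒≢ () refl | true | refl

  rank-mono : ∀ {x y z} → y ∈ P → z ∈ P → strictlyBetween x y z ≡ true → rank z < rank y
  rank-mono {x} {y} {z} y∈ z∈ b
    with _ , b′ ← ∧-true⁻ {x ≤ᵇ z} b with z≤y , z≢y ← ∧-true⁻ {z ≤ᵇ y} b′
    = countᵇ-mono-< (_≤ᵇ z) (_≤ᵇ y) P (λ w w≤z → ≤ᵇ-trans w≤z z≤y) y∈ y≰z (≤ᵇ-refl y)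
    where
    y≰z : y ≤ᵇ z ≡ false
    y≰z with y ≤ᵇ z in y≤z
    ... | true  = contradiction (≤ᵇ-antisym z∈ y∈ z≤y y≤z) (strict⇒≢ z≢y)
    ... | false = refl

  -- Recursive calls go to some z strictly below y, so the bound by `rank` survives the loss of one
  -- unit of fuel; `rank-pos` rules out empty fuel.
  fuel-irrelevant : ∀ x {y} → y ∈ P → ∀ f f′ → rank y ≤ f → rank y ≤ f′ → μ-fuel f x y ≡ μ-fuel f′ x y
  fuel-irrelevant x y∈ zero    f′       r≤ _  = contradiction (ℕ.<-≤-trans (rank-pos y∈) r≤) λ ()
  fuel-irrelevant x y∈ (suc f) zero     _  r≤ = contradiction (ℕ.<-≤-trans (rank-pos y∈) r≤) λ ()
  fuel-irrelevant x {y} y∈ (suc f) (suc f′) r≤ r≤′ =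
    cong (λ s → if x ≡ᵇ y then 1ℤ else if x ≤ᵇ y then - s else 0ℤ)
      (Σ-cong (filterᵇ (strictlyBetween x y) P) λ {z} z∈ →
        let z∈P , b = ∈-filterᵇ⁻ (strictlyBetween x y) z∈
            r< = rank-mono y∈ z∈P b
        in fuel-irrelevant x z∈P f f′ (ℕ.≤-pred (ℕ.≤-trans r< r≤)) (ℕ.≤-pred (ℕ.≤-trans r< r≤′)))

  μ-unfold : ∀ x {y} → y ∈ P →
    μ x y ≡ (if x ≡ᵇ y then 1ℤ else if x ≤ᵇ y then - Σ (filterᵇ (strictlyBetween x y) P) (μ x) else 0ℤ)
  μ-unfold x {y} y∈ = ≡.trans
    -- With one extra unit of fuel the `suc` clause of `μ-fuel` applies by computation, and its
    -- recursive calls run on `length P`, so they are literally `μ x`.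
    (fuel-irrelevant x y∈ (length P) (suc (length P)) r≤ (ℕ.m≤n⇒m≤1+n r≤)) refl
    where r≤ = countᵇ≤length (_≤ᵇ y) P

  -- Split off the term z = y. For x < y the recursion makes it the negative of all the others; for
  -- x = y, and for x not below y, there are no others, by antisymmetry and transitivity.
  Σμ≡δ : ∀ {x y} → x ∈ P → y ∈ P →
         Σ P (λ z → if (x ≤ᵇ z) ∧ (z ≤ᵇ y) then μ x z else 0ℤ) ≡ (if x ≡ᵇ y then 1ℤ else 0ℤ)
  Σμ≡δ {x} {y} x∈ y∈ = begin
    Σ P (λ z → if (x ≤ᵇ z) ∧ (z ≤ᵇ y) then μ x z else 0ℤ)
      ≡⟨ Σ-cong P (λ {z} _ → split z) ⟩
    Σ P (λ z → (if strictlyBetween x y z then μ x z else 0ℤ) +ℤ atTop z)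
      ≡⟨ Σ-+ P _ atTop ⟩
    Σ P (λ z → if strictlyBetween x y z then μ x z else 0ℤ) +ℤ Σ P atTop
      ≡⟨ cong₂ _+ℤ_ (sym (Σ-filterᵇ (strictlyBetween x y) (μ x) P)) (Σ-single atTop P! y∈ off-top) ⟩
    S +ℤ atTop y
      ≡⟨ cong (S +ℤ_) at-y ⟩
    S +ℤ (if x ≤ᵇ y then (if x ≡ᵇ y then 1ℤ else if x ≤ᵇ y then - S else 0ℤ) else 0ℤ)
      ≡⟨ finish ⟩
    (if x ≡ᵇ y then 1ℤ else 0ℤ) ∎
    where
    open ≡-Reasoning
    S : ℤ
    S = Σ (filterᵇ (strictlyBetween x y) P) (μ x)
    atTop : A → ℤ
    atTop z = if z ≡ᵇ y then (if x ≤ᵇ y then μ x y else 0ℤ) else 0ℤ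
    split : ∀ z → (if (x ≤ᵇ z) ∧ (z ≤ᵇ y) then μ x z else 0ℤ)
                ≡ (if strictlyBetween x y z then μ x z else 0ℤ) +ℤ atTop z
    split z with z ≡ᵇ y in z≡y
    split z | true with refl ← ≡ᵇ⇒≡ z≡y rewrite ≤ᵇ-refl z with x ≤ᵇ z
    ... | true  = sym (ℤ.+-identityˡ _)
    ... | false = refl
    split z | false with x ≤ᵇ z | z ≤ᵇ y
    ... | true  | true  = sym (ℤ.+-identityʳ _)
    ... | true  | false = refl
    ... | false | _     = refl
    off-top : ∀ {z} → z ∈ P → z ≢ y → atTop z ≡ 0ℤ
    off-top {z} _ z≢y with z ≡ᵇ y in z≡y
    ... | true  = contradiction (≡ᵇ⇒≡ z≡y) z≢y
    ... | false = refl
    at-y : atTop y ≡ (if x ≤ᵇ y then (if x ≡ᵇ y then 1ℤ else if x ≤ᵇ y then - S else 0ℤ) else 0ℤ)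
    at-y rewrite ≡ᵇ-refl y = cong (λ v → if x ≤ᵇ y then v else 0ℤ) (μ-unfold x y∈)
    S≡0 : (∀ {z} → z ∈ P → strictlyBetween x y z ≢ true) → S ≡ 0ℤ
    S≡0 none = ≡.trans (Σ-cong (filterᵇ (strictlyBetween x y) P)
      λ z∈ → let z∈P , b = ∈-filterᵇ⁻ (strictlyBetween x y) z∈ in ⊥-elim (none z∈P b))
      (Σ-0 (filterᵇ (strictlyBetween x y) P))
    finish : S +ℤ (if x ≤ᵇ y then (if x ≡ᵇ y then 1ℤ else if x ≤ᵇ y then - S else 0ℤ) else 0ℤ)
             ≡ (if x ≡ᵇ y then 1ℤ else 0ℤ)
    finish with x ≡ᵇ y in x≡y
    finish | true with refl ← ≡ᵇ⇒≡ x≡y rewrite ≤ᵇ-refl x = cong (_+ℤ 1ℤ) (S≡0 none)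
      where
      none : ∀ {z} → z ∈ P → strictlyBetween x x z ≢ true
      none {z} z∈ b with x≤z , b′ ← ∧-true⁻ {x ≤ᵇ z} b with z≤x , z≢x ← ∧-true⁻ {z ≤ᵇ x} b′
        = strict⇒≢ z≢x (≤ᵇ-antisym z∈ x∈ z≤x x≤z)
    finish | false with x ≤ᵇ y in x≤y
    ... | true  = ℤ.+-inverseʳ S
    ... | false = ≡.trans (ℤ.+-identityʳ S) (S≡0 none)
      where
      none : ∀ {z} → z ∈ P → strictlyBetween x y z ≢ true
      none {z} z∈ b with x≤z , b′ ← ∧-true⁻ {x ≤ᵇ z} b with z≤y , _ ← ∧-true⁻ {z ≤ᵇ y} b′
        = contradiction (≡.trans (sym x≤y) (≤ᵇ-trans x≤z z≤y)) λ ()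

  -- Only Σ_{x≤z≤y} μ(x,z) = δ is used, which the recursion defining μ gives directly.
  möbius-inversion : (m l : A → ℤ) {x : A} → x ∈ P →
    (∀ {z} → z ∈ P → x ≤ᵇ z ≡ true → m z ≡ Σ P (λ y → if z ≤ᵇ y then l y else 0ℤ)) →
    Σ P (λ z → if x ≤ᵇ z then μ x z *ℤ m z else 0ℤ) ≡ l x
  möbius-inversion m l {x} x∈ m≡ = begin
    Σ P (λ z → if x ≤ᵇ z then μ x z *ℤ m z else 0ℤ)
      ≡⟨ Σ-cong P (λ {z} z∈ → expand z z∈) ⟩
    Σ P (λ z → Σ P (λ y → (if (x ≤ᵇ z) ∧ (z ≤ᵇ y) then μ x z else 0ℤ) *ℤ l y))
      ≡⟨ Σ-swap P P _ ⟩
    Σ P (λ y → Σ P (λ z → (if (x ≤ᵇ z) ∧ (z ≤ᵇ y) then μ x z else 0ℤ) *ℤ l y))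
      ≡⟨ Σ-cong P (λ {y} y∈ → ≡.trans (Σ-*ʳ P _ (l y)) (cong (_*ℤ l y) (Σμ≡δ x∈ y∈))) ⟩
    Σ P (λ y → (if x ≡ᵇ y then 1ℤ else 0ℤ) *ℤ l y)
      ≡⟨ Σ-single _ P! x∈ off ⟩
    (if x ≡ᵇ x then 1ℤ else 0ℤ) *ℤ l x
      ≡⟨ cong (λ b → (if b then 1ℤ else 0ℤ) *ℤ l x) (≡ᵇ-refl x) ⟩
    1ℤ *ℤ l x
      ≡⟨ ℤ.*-identityˡ (l x) ⟩
    l x ∎
    where
    open ≡-Reasoning
    expand : ∀ z → z ∈ P → (if x ≤ᵇ z then μ x z *ℤ m z else 0ℤ)
           ≡ Σ P (λ y → (if (x ≤ᵇ z) ∧ (z ≤ᵇ y) then μ x z else 0ℤ) *ℤ l y)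
    expand z z∈ with x ≤ᵇ z in x≤z
    ... | false = sym (Σ-0 P)
    ... | true  = begin
      μ x z *ℤ m z
        ≡⟨ cong (μ x z *ℤ_) (m≡ z∈ x≤z) ⟩
      μ x z *ℤ Σ P (λ y → if z ≤ᵇ y then l y else 0ℤ)
        ≡⟨ Σ-*ˡ P _ (μ x z) ⟨
      Σ P (λ y → μ x z *ℤ (if z ≤ᵇ y then l y else 0ℤ))
        ≡⟨ Σ-cong P (λ {y} _ → move y) ⟩
      Σ P (λ y → (if z ≤ᵇ y then μ x z else 0ℤ) *ℤ l y) ∎
      where
      move : ∀ y → μ x z *ℤ (if z ≤ᵇ y then l y else 0ℤ) ≡ (if z ≤ᵇ y then μ x z else 0ℤ) *ℤ l y
      move y with z ≤ᵇ y
      ... | true  = refl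
      ... | false = ℤ.*-zeroʳ (μ x z)
    off : ∀ {y} → y ∈ P → y ≢ x → (if x ≡ᵇ y then 1ℤ else 0ℤ) *ℤ l y ≡ 0ℤ
    off {y} _ y≢x with x ≡ᵇ y in x≡y
    ... | true  = contradiction (sym (≡ᵇ⇒≡ x≡y)) y≢x
    ... | false = refl

-- The operators T and F; Bell numbers

iterate-suc : (f : A → A) (x : A) (n : ℕ) → iterate f (f x) n ≡ f (iterate f x n)
iterate-suc f x zero    = refl
iterate-suc f x (suc n) = iterate-suc f (f x) n

iterate-+ : (f : A → A) (x : A) (m n : ℕ) → iterate f (iterate f x m) n ≡ iterate f x (m + n)
iterate-+ f x zero    n = refl
iterate-+ f x (suc m) n = iterate-+ f (f x) m n

Congruent : ((ℕ → A) → (ℕ → B)) → Set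
Congruent f = ∀ {w w′} → w ≗ w′ → f w ≗ f w′

iterate-cong : {f : (ℕ → A) → (ℕ → A)} → Congruent f → (n : ℕ) → Congruent (λ w → iterate f w n)
iterate-cong f-cong zero    eq = eq
iterate-cong f-cong (suc n) eq = iterate-cong f-cong n (f-cong eq)

-- Weights are compared only pointwise, so pushing h through the iteration needs g to respect
-- pointwise equality.
iterate-natural : {f : (ℕ → A) → (ℕ → A)} {g : (ℕ → B) → (ℕ → B)} (h : (ℕ → A) → (ℕ → B)) →
                  Congruent g → (∀ w → h (f w) ≗ g (h w)) →
                  ∀ n w → h (iterate f w n) ≗ iterate g (h w) n
iterate-natural h g-cong hf≗gh zero    w b = refl
iterate-natural {f = f} h g-cong hf≗gh (suc n) w b =
  ≡.trans (iterate-natural h g-cong hf≗gh n (f w) b)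
          (iterate-cong g-cong n (hf≗gh w) b)

-- A function w of the number b of labelled blocks is summed over the ways to
-- insert one more element: into a labelled block, old or new (T), or also
-- into the one permitted unlabelled block (F).
T : (ℕ → ℤ) → ℕ → ℤ
T w b = pos b *ℤ w b +ℤ w (suc b)

F : (ℕ → ℤ) → ℕ → ℤ
F w b = T w b +ℤ w b

T-cong : Congruent T
T-cong eq b = cong₂ _+ℤ_ (cong (pos b *ℤ_) (eq b)) (eq (suc b))

F-cong : Congruent F
F-cong eq b = cong₂ _+ℤ_ (T-cong eq b) (eq b)

-- Since F is T plus the identity. Thus the order in which labelled and unlabelled blocks of π are
-- met does not affect the sum, only their numbers.
FT≗TF : ∀ w → F (T w) ≗ T (F w)
FT≗TF w b = lemma (pos b) (T w b) (T w (suc b)) (w b) (w (suc b))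
  where
  lemma : ∀ b x y z u → (b *ℤ x +ℤ y) +ℤ (b *ℤ z +ℤ u) ≡ b *ℤ (x +ℤ z) +ℤ (y +ℤ u)
  lemma = ℤ-Solver.solve-∀

Tᴺ : (ℕ → ℕ) → ℕ → ℕ
Tᴺ v b = b * v b + v (suc b)

Fᴺ : (ℕ → ℕ) → ℕ → ℕ
Fᴺ v b = Tᴺ v b + v b

Tᴺ-cong : Congruent Tᴺ
Tᴺ-cong eq b = cong₂ _+_ (cong (b *_) (eq b)) (eq (suc b))

Fᴺ-cong : Congruent Fᴺ
Fᴺ-cong eq b = cong₂ _+_ (Tᴺ-cong eq b) (eq b)

pos-Tᴺ : ∀ v → (pos ∘ Tᴺ v) ≗ T (pos ∘ v)
pos-Tᴺ v b = ≡.trans (ℤ.pos-+ (b * v b) (v (suc b))) (cong (_+ℤ pos (v (suc b))) (ℤ.pos-* b (v b)))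

pos-Fᴺ : ∀ v → (pos ∘ Fᴺ v) ≗ F (pos ∘ v)
pos-Fᴺ v b = ≡.trans (ℤ.pos-+ (Tᴺ v b) (v b)) (cong (_+ℤ pos (v b)) (pos-Tᴺ v b))

sumTo-cong : ∀ m {f g : ℕ → ℕ} → (∀ {j} → j ≤ m → f j ≡ g j) → sumTo m f ≡ sumTo m g
sumTo-cong zero    f≡g = f≡g z≤n
sumTo-cong (suc m) f≡g = cong₂ _+_ (sumTo-cong m (f≡g ∘ ℕ.m≤n⇒m≤1+n)) (f≡g ℕ.≤-refl)

sumTo-+ : ∀ m (f g : ℕ → ℕ) → sumTo m (λ j → f j + g j) ≡ sumTo m f + sumTo m g
sumTo-+ zero    f g = refl
sumTo-+ (suc m) f g = ≡.trans (cong (_+ (f (suc m) + g (suc m))) (sumTo-+ m f g))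
                              (interchange ℕ.+-commutativeSemigroup (sumTo m f) (sumTo m g) (f (suc m)) (g (suc m)))

sumTo-suc : ∀ m (f : ℕ → ℕ) → sumTo (suc m) f ≡ f 0 + sumTo m (f ∘ suc)
sumTo-suc zero    f = refl
sumTo-suc (suc m) f = ≡.trans (cong (_+ f (suc (suc m))) (sumTo-suc m f)) (ℕ.+-assoc (f 0) _ _)

sumTo-shift : ∀ m (f : ℕ → ℕ) → f (suc m) ≡ 0 → sumTo m f ≡ f 0 + sumTo m (f ∘ suc)
sumTo-shift m f f≡0 = begin
  sumTo m f              ≡⟨ ℕ.+-identityʳ _ ⟨
  sumTo m f + 0          ≡⟨ cong (sumTo m f +_) f≡0 ⟨
  sumTo (suc m) f        ≡⟨ sumTo-suc m f ⟩
  f 0 + sumTo m (f ∘ suc) ∎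
  where open ≡-Reasoning

stirling2-above : ∀ {m k} → m < k → stirling2 m k ≡ 0
stirling2-above {zero}  {suc k} _ = refl
stirling2-above {suc m} {suc k} (s≤s m<k)
  rewrite stirling2-above {m} {suc k} (ℕ.m≤n⇒m≤1+n m<k) | stirling2-above m<k | ℕ.*-zeroʳ k = refl

-- T is the transpose of the Stirling recurrence: collecting the terms k v(k) + v(k+1) by the
-- argument of v turns row m into row m + 1.
iterate-Tᴺ : ∀ m v → iterate Tᴺ v m 0 ≡ sumTo m (λ k → stirling2 m k * v k)
iterate-Tᴺ zero    v = sym (ℕ.+-identityʳ (v 0))
iterate-Tᴺ (suc m) v = begin
  iterate Tᴺ (Tᴺ v) m 0
    ≡⟨ iterate-Tᴺ m (Tᴺ v) ⟩
  sumTo m (λ k → S k * (k * v k + v (suc k)))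
    ≡⟨ sumTo-cong m (λ {k} _ → ℕ.*-distribˡ-+ (S k) (k * v k) (v (suc k))) ⟩
  sumTo m (λ k → S k * (k * v k) + S k * v (suc k))
    ≡⟨ sumTo-+ m _ _ ⟩
  sumTo m (λ k → S k * (k * v k)) + sumTo m (λ k → S k * v (suc k))
    -- The index can be shifted without changing the range: the term at 0 has the factor k = 0, and
    -- the term at m + 1 has S(m, m+1) = 0.
    ≡⟨ cong (_+ sumTo m (λ k → S k * v (suc k))) (≡.trans
         (sumTo-shift m (λ k → S k * (k * v k))
           (cong (_* (suc m * v (suc m))) (stirling2-above (ℕ.n<1+n m))))
         (cong (_+ sumTo m (λ k → S (suc k) * (suc k * v (suc k)))) (ℕ.*-zeroʳ (S 0)))) ⟩
  sumTo m (λ k → S (suc k) * (suc k * v (suc k))) + sumTo m (λ k → S k * v (suc k))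
    ≡⟨ sumTo-+ m _ _ ⟨
  sumTo m (λ k → S (suc k) * (suc k * v (suc k)) + S k * v (suc k))
    ≡⟨ sumTo-cong m (λ {k} _ → lemma (S (suc k)) (suc k) (v (suc k)) (S k)) ⟩
  sumTo m (λ k → stirling2 (suc m) (suc k) * v (suc k))
    ≡⟨ sumTo-suc m (λ k → stirling2 (suc m) k * v k) ⟨
  sumTo (suc m) (λ k → stirling2 (suc m) k * v k) ∎
  where
  open ≡-Reasoning
  S : ℕ → ℕ
  S = stirling2 m
  lemma : ∀ s k v s′ → s * (k * v) + s′ * v ≡ (k * s + s′) * v
  lemma = solve-∀

iterate-Tᴺ≡bell : ∀ m → iterate Tᴺ (λ _ → 1) m 0 ≡ bell m
iterate-Tᴺ≡bell m = ≡.trans (iterate-Tᴺ m (λ _ → 1))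
                            (sumTo-cong m λ {k} _ → ℕ.*-identityʳ (stirling2 m k))

Tᴺ-+ : ∀ m v v′ b → iterate Tᴺ (λ c → v c + v′ c) m b ≡ iterate Tᴺ v m b + iterate Tᴺ v′ m b
Tᴺ-+ zero    v v′ b = refl
Tᴺ-+ (suc m) v v′ b = ≡.trans
  (iterate-cong Tᴺ-cong m (λ c → lemma c (v c) (v′ c) (v (suc c)) (v′ (suc c))) b)
  (Tᴺ-+ m (Tᴺ v) (Tᴺ v′) b)
  where
  lemma : ∀ c x y z u → c * (x + y) + (z + u) ≡ (c * x + z) + (c * y + u)
  lemma = solve-∀

-- The binomial theorem for (T + 1)^f, by Pascal's rule; j counts the factors in which the identity
-- is chosen, that is, the insertions into the unlabelled block.
iterate-Fᴺ : ∀ f v b → iterate Fᴺ v f b ≡ sumTo f (λ j → (f C j) * iterate Tᴺ v (f ∸ j) b)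
iterate-Fᴺ zero    v b = sym (ℕ.+-identityʳ (v b))
iterate-Fᴺ (suc f) v b = begin
  iterate Fᴺ (Fᴺ v) f b
    ≡⟨ iterate-Fᴺ f (Fᴺ v) b ⟩
  sumTo f (λ j → (f C j) * iterate Tᴺ (Fᴺ v) (f ∸ j) b)
    ≡⟨ sumTo-cong f (λ {j} j≤f → ≡.trans
         (cong ((f C j) *_) (Tᴺ-+ (f ∸ j) (Tᴺ v) v b))
         (≡.trans (cong (λ i → (f C j) * (Tv i + Tv (f ∸ j))) (sym (ℕ.+-∸-assoc 1 j≤f)))
                  (ℕ.*-distribˡ-+ (f C j) (Tv (suc f ∸ j)) (Tv (f ∸ j))))) ⟩
  sumTo f (λ j → (f C j) * Tv (suc f ∸ j) + (f C j) * Tv (f ∸ j))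
    ≡⟨ sumTo-+ f _ _ ⟩
  sumTo f (λ j → (f C j) * Tv (suc f ∸ j)) + sumTo f (λ j → (f C j) * Tv (f ∸ j))
    ≡⟨ cong (_+ sumTo f (λ j → (f C j) * Tv (f ∸ j)))
         (sumTo-shift f (λ j → (f C j) * Tv (suc f ∸ j))
           (cong (_* Tv (f ∸ f)) (k>n⇒nCk≡0 (ℕ.n<1+n f)))) ⟩
  (1 * Tv (suc f) + sumTo f (λ j → (f C suc j) * Tv (f ∸ j))) + sumTo f (λ j → (f C j) * Tv (f ∸ j))
    ≡⟨ ≡.trans (ℕ.+-assoc (1 * Tv (suc f)) _ _)
         (cong (1 * Tv (suc f) +_) (ℕ.+-comm (sumTo f (λ j → (f C suc j) * Tv (f ∸ j))) _)) ⟩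
  1 * Tv (suc f) + (sumTo f (λ j → (f C j) * Tv (f ∸ j)) + sumTo f (λ j → (f C suc j) * Tv (f ∸ j)))
    ≡⟨ cong (1 * Tv (suc f) +_) (sumTo-+ f _ _) ⟨
  1 * Tv (suc f) + sumTo f (λ j → (f C j) * Tv (f ∸ j) + (f C suc j) * Tv (f ∸ j))
    ≡⟨ cong (1 * Tv (suc f) +_) (sumTo-cong f λ {j} _ → ≡.trans
         (sym (ℕ.*-distribʳ-+ (Tv (f ∸ j)) (f C j) (f C suc j)))
         (cong (_* Tv (f ∸ j)) (nCk+nC[k+1]≡[n+1]C[k+1] f j))) ⟩
  1 * Tv (suc f) + sumTo f (λ j → (suc f C suc j) * Tv (f ∸ j))
    ≡⟨ sumTo-suc f (λ j → (suc f C j) * Tv (suc f ∸ j)) ⟨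
  sumTo (suc f) (λ j → (suc f C j) * Tv (suc f ∸ j)) ∎
  where
  open ≡-Reasoning
  Tv : ℕ → ℕ
  Tv m = iterate Tᴺ v m b

-- One labelled block set aside is one more place for the new element, exactly as the permitted
-- unlabelled block is.
Tᴺ-shift : ∀ v → (Tᴺ v ∘ suc) ≗ Fᴺ (v ∘ suc)
Tᴺ-shift v b = lemma b (v (suc b)) (v (suc (suc b)))
  where
  lemma : ∀ b x y → suc b * x + y ≡ (b * x + y) + x
  lemma = solve-∀

bell-suc : ∀ n → bell (suc n) ≡ sumTo n (λ j → (n C j) * bell (n ∸ j))
bell-suc n = begin
  bell (suc n)
    ≡⟨ iterate-Tᴺ≡bell (suc n) ⟨
  iterate Tᴺ (λ _ → 1) (suc n) 0
    -- At 0 the outermost T reduces to the value at 1: the first element has no choice but to open a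
    -- block, which is then the one set aside.
    ≡⟨ cong (λ w → w 0) (iterate-suc Tᴺ (λ _ → 1) n) ⟩
  iterate Tᴺ (λ _ → 1) n 1
    ≡⟨ iterate-natural (_∘ suc) Fᴺ-cong Tᴺ-shift n (λ _ → 1) 0 ⟩
  iterate Fᴺ (λ _ → 1) n 0
    ≡⟨ iterate-Fᴺ n (λ _ → 1) 0 ⟩
  sumTo n (λ j → (n C j) * iterate Tᴺ (λ _ → 1) (n ∸ j) 0)
    ≡⟨ sumTo-cong n (λ {j} _ → cong ((n C j) *_) (iterate-Tᴺ≡bell (n ∸ j))) ⟩
  sumTo n (λ j → (n C j) * bell (n ∸ j)) ∎
  where open ≡-Reasoning

-- The weights for P₀ and for λ

positive : ℕ → ℕ
positive zero    = 0
positive (suc _) = 1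

-- `positive` and the constant 1 differ only at 0, where T multiplies the value by 0; one T makes
-- them equal. Without any T the values at 0 are 0 and B(0) = 1, and this is why the sum for k = 0
-- stops at n - 1.
iterate-Tᴺ-positive : ∀ m → iterate Tᴺ positive (suc m) 0 ≡ bell (suc m)
iterate-Tᴺ-positive m =
  ≡.trans (iterate-cong Tᴺ-cong m (λ { zero → refl ; (suc b) → refl }) 0) (iterate-Tᴺ≡bell (suc m))

isZero : ℕ → ℤ
isZero zero    = 1ℤ
isZero (suc _) = 0ℤ

-- The Möbius number (-1)^(b-1) (b-1)! of the lattice of partitions of b blocks; 0 at b = 0.
partitionMöbius : ℕ → ℤ
partitionMöbius zero          = 0ℤ
partitionMöbius (suc zero)    = 1ℤ
partitionMöbius (suc (suc b)) = - (pos (suc b) *ℤ partitionMöbius (suc b))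

partitionMöbius≢0 : ∀ b → partitionMöbius (suc b) ≢ 0ℤ
partitionMöbius≢0 zero    ()
partitionMöbius≢0 (suc b) eq
  with ℤ.i*j≡0⇒i≡0∨j≡0 (pos (suc b)) (ℤ.neg-injective {j = 0ℤ} eq)
... | inj₂ eq′ = partitionMöbius≢0 b eq′

T-partitionMöbius : T partitionMöbius ≗ isZero
T-partitionMöbius zero    = refl
T-partitionMöbius (suc b) = ℤ.+-inverseʳ (pos (suc b) *ℤ partitionMöbius (suc b))

T-isZero : T isZero ≗ (λ _ → 0ℤ)
T-isZero zero    = refl
T-isZero (suc b) = ≡.trans (ℤ.+-identityʳ _) (ℤ.*-zeroʳ (pos (suc b)))

F-isZero : F isZero ≗ isZero
F-isZero b = ≡.trans (cong (_+ℤ isZero b) (T-isZero b)) (ℤ.+-identityˡ _)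

T-0 : T (λ _ → 0ℤ) ≗ (λ _ → 0ℤ)
T-0 b = ≡.trans (ℤ.+-identityʳ _) (ℤ.*-zeroʳ (pos b))

F-0 : F (λ _ → 0ℤ) ≗ (λ _ → 0ℤ)
F-0 b = ≡.trans (ℤ.+-identityʳ _) (T-0 b)

iterate-fixed : {f : (ℕ → A) → (ℕ → A)} → Congruent f → ∀ {w} → f w ≗ w → ∀ n → iterate f w n ≗ w
iterate-fixed f-cong fw≗w zero    b = refl
iterate-fixed f-cong fw≗w (suc n) b =
  ≡.trans (iterate-cong f-cong n fw≗w b) (iterate-fixed f-cong fw≗w n b)

-- The first T yields `isZero`, a second one kills it, and F fixes both results. With `suc t`
-- labelled blocks the value is m.
FT-partitionMöbius : ∀ f t → iterate F (iterate T partitionMöbius (suc t)) f 0 ≡ isZero t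
FT-partitionMöbius f zero = ≡.trans (iterate-cong F-cong f T-partitionMöbius 0)
                                    (iterate-fixed F-cong F-isZero f 0)
FT-partitionMöbius f (suc t) = ≡.trans
  (iterate-cong F-cong f (λ b → ≡.trans
    (iterate-cong T-cong t (λ c → ≡.trans (T-cong T-partitionMöbius c) (T-isZero c)) b)
    (iterate-fixed T-cong T-0 t b)) 0)
  (iterate-fixed F-cong F-0 f 0)

iterate-FT-pos : ∀ f t v → iterate F (iterate T (pos ∘ v) t) f 0 ≡ pos (iterate Fᴺ (iterate Tᴺ v t) f 0)
iterate-FT-pos f t v = sym (≡.trans
  (iterate-natural (pos ∘_) F-cong pos-Fᴺ f (iterate Tᴺ v t) 0)
  (iterate-cong F-cong f (iterate-natural (pos ∘_) T-cong pos-Tᴺ t v) 0))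

-- At least one T comes from a labelled block, so every term of the expansion of (T + 1)^f, even j =
-- f, is a Bell number.
iterate-FᴺTᴺ-positive : ∀ f t → iterate Fᴺ (iterate Tᴺ positive (suc t)) f 0
                        ≡ sumTo f (λ j → (f C j) * bell ((suc t + f) ∸ j))
iterate-FᴺTᴺ-positive f t = ≡.trans (iterate-Fᴺ f (iterate Tᴺ positive (suc t)) 0)
  (sumTo-cong f λ {j} j≤f → cong ((f C j) *_) (begin
    iterate Tᴺ (iterate Tᴺ positive (suc t)) (f ∸ j) 0
      ≡⟨ cong (λ w → w 0) (iterate-+ Tᴺ positive (suc t) (f ∸ j)) ⟩
    iterate Tᴺ positive (suc t + (f ∸ j)) 0
      ≡⟨ iterate-Tᴺ-positive (t + (f ∸ j)) ⟩
    bell (suc t + (f ∸ j))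
      ≡⟨ cong bell (ℕ.+-∸-assoc (suc t) j≤f) ⟨
    bell ((suc t + f) ∸ j) ∎))
  where open ≡-Reasoning

iterate-Fᴺ-positive : ∀ n → iterate Fᴺ positive (suc n) 0
                      ≡ sumTo n (λ j → (suc n C j) * bell (suc n ∸ j))
iterate-Fᴺ-positive n = begin
  iterate Fᴺ positive (suc n) 0
    ≡⟨ iterate-Fᴺ (suc n) positive 0 ⟩
  sumTo n (λ j → (suc n C j) * iterate Tᴺ positive (suc n ∸ j) 0)
    + (suc n C suc n) * iterate Tᴺ positive (n ∸ n) 0
    ≡⟨ cong₂ _+_ (sumTo-cong n λ {j} j≤n → cong ((suc n C j) *_) (step j≤n))
         -- In the last term, j = `suc n`, no T is left, and `positive 0` is 0.
         (≡.trans (cong (λ m → (suc n C suc n) * iterate Tᴺ positive m 0) (ℕ.n∸n≡0 n))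
                  (ℕ.*-zeroʳ (suc n C suc n))) ⟩
  sumTo n (λ j → (suc n C j) * bell (suc n ∸ j)) + 0
    ≡⟨ ℕ.+-identityʳ _ ⟩
  sumTo n (λ j → (suc n C j) * bell (suc n ∸ j)) ∎
  where
  open ≡-Reasoning
  step : ∀ {j} → j ≤ n → iterate Tᴺ positive (suc n ∸ j) 0 ≡ bell (suc n ∸ j)
  step {j} j≤n rewrite ℕ.+-∸-assoc 1 j≤n = iterate-Tᴺ-positive (n ∸ j)

-- Labelled set partitions

does⇒ : {P : Set} (P? : Dec P) → does P? ≡ true → P
does⇒ (yes p) _ = p

all-tabulate⁻ : (p : A → Bool) (f : Fin n → A) → all p (tabulate f) ≡ true → ∀ i → p (f i) ≡ true
all-tabulate⁻ p f h zero    = proj₁ (∧-true⁻ h)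
all-tabulate⁻ p f h (suc i) = all-tabulate⁻ p (f ∘ suc) (proj₂ (∧-true⁻ {p (f zero)} h)) i

all-tabulate⁺ : (p : A → Bool) (f : Fin n → A) → (∀ i → p (f i) ≡ true) → all p (tabulate f) ≡ true
all-tabulate⁺ {n = zero}  p f h = refl
all-tabulate⁺ {n = suc n} p f h = cong₂ _∧_ (h zero) (all-tabulate⁺ p (f ∘ suc) (h ∘ suc))

boolEq⇒≡ : ∀ {a b} → boolEq a b ≡ true → a ≡ b
boolEq⇒≡ {true}  {true}  _ = refl
boolEq⇒≡ {false} {false} _ = refl

≡⇒boolEq : ∀ {a b} → a ≡ b → boolEq a b ≡ true
≡⇒boolEq {true}  refl = refl
≡⇒boolEq {false} refl = refl

⇒ᵇ⁻ : ∀ {a b} → (a ⇒ᵇ b) ≡ true → a ≡ true → b ≡ true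
⇒ᵇ⁻ h refl = h

⇒ᵇ⁺ : ∀ {a b} → (a ≡ true → b ≡ true) → (a ⇒ᵇ b) ≡ true
⇒ᵇ⁺ {true}  h = h refl
⇒ᵇ⁺ {false} h = refl

record Valid (σ : LP n) : Set where
  constructor mkValid
  field
    blk≤    : ∀ i → toℕ (blk σ i) ≤ toℕ i
    blk-blk : ∀ i → blk σ (blk σ i) ≡ blk σ i
    lab-blk : ∀ i → lab σ i ≡ lab σ (blk σ i)

open Valid public

record _≼_ (σ π : LP n) : Set where
  constructor mk≼
  field
    blk-mono : ∀ i j → blk σ i ≡ blk σ j → blk π i ≡ blk π j
    lab-mono : ∀ i → lab σ i ≡ true → lab π i ≡ true

open _≼_ public

valid⁻ : (σ : LP n) → valid σ ≡ true → Valid σ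
valid⁻ σ v = mkValid
  (λ i → does⇒ (_ ℕ.≤? _) (proj₁ (∧-true⁻ (v′ i))))
  (λ i → does⇒ (_ Fin.≟ _) (proj₁ (∧-true⁻ (rest i))))
  (λ i → boolEq⇒≡ (proj₂ (∧-true⁻ {blk σ (blk σ i) ≟ᶠ blk σ i} (rest i))))
  where
  v′ = all-tabulate⁻ _ id v
  rest = λ i → proj₂ (∧-true⁻ {does (toℕ (blk σ i) ℕ.≤? toℕ i)} (v′ i))

valid⁺ : (σ : LP n) → Valid σ → valid σ ≡ true
valid⁺ σ v = all-tabulate⁺ _ id λ i →
  cong₂ _∧_ (dec-true (_ ℕ.≤? _) (blk≤ v i))
            (cong₂ _∧_ (dec-true (_ Fin.≟ _) (blk-blk v i)) (≡⇒boolEq (lab-blk v i)))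

≤LP⁻ : (σ π : LP n) → σ ≤LP π ≡ true → σ ≼ π
≤LP⁻ σ π h = mk≼
  (λ i j eq → does⇒ (_ Fin.≟ _)
    (⇒ᵇ⁻ (all-tabulate⁻ _ id (proj₁ (∧-true⁻ (h′ i))) j) (dec-true (_ Fin.≟ _) eq)))
  (λ i → ⇒ᵇ⁻ (proj₂ (∧-true⁻ {all (λ j → (blk σ i ≟ᶠ blk σ j) ⇒ᵇ (blk π i ≟ᶠ blk π j)) (allFin _)} (h′ i))))
  where h′ = all-tabulate⁻ _ id h

≤LP⁺ : (σ π : LP n) → σ ≼ π → σ ≤LP π ≡ true
≤LP⁺ σ π h = all-tabulate⁺ _ id λ i → cong₂ _∧_
  (all-tabulate⁺ _ id λ j → ⇒ᵇ⁺ λ eq → dec-true (_ Fin.≟ _) (blk-mono h i j (does⇒ (_ Fin.≟ _) eq)))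
  (⇒ᵇ⁺ (lab-mono h i))

≼-refl : (σ : LP n) → σ ≼ σ
≼-refl σ = mk≼ (λ _ _ → id) (λ _ → id)

≼-trans : {σ π ρ : LP n} → σ ≼ π → π ≼ ρ → σ ≼ ρ
≼-trans p q = mk≼ (λ i j → blk-mono q i j ∘ blk-mono p i j) (λ i → lab-mono q i ∘ lab-mono p i)

vec-ext : {u v : Vec A n} → (∀ i → lookup u i ≡ lookup v i) → u ≡ v
vec-ext {u = []}    {[]}    h = refl
vec-ext {u = x ∷ u} {y ∷ v} h = cong₂ _∷_ (h zero) (vec-ext (h ∘ suc))

LP-ext : {σ π : LP n} → (∀ i → blk σ i ≡ blk π i) → (∀ i → lab σ i ≡ lab π i) → σ ≡ π
LP-ext b l = cong₂ _,_ (vec-ext b) (vec-ext l)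

-- Coarser blocks have smaller least elements: if π ≼ σ, then `blk π i` lies in the σ-block of i, so
-- it is at least `blk σ i`. Both directions give equality.
≼-antisym : {σ π : LP n} → Valid σ → Valid π → σ ≼ π → π ≼ σ → σ ≡ π
≼-antisym {σ = σ} {π} vσ vπ p q = LP-ext
  (λ i → Fin.toℕ-injective (ℕ.≤-antisym (below vσ vπ q i) (below vπ vσ p i)))
  (λ i → same (lab-mono p i) (lab-mono q i))
  where
  below : {σ π : LP _} → Valid σ → Valid π → π ≼ σ → ∀ i → toℕ (blk σ i) ≤ toℕ (blk π i)
  below {σ} {π} vσ vπ q i = subst (λ j → toℕ j ≤ toℕ (blk π i))
    (blk-mono q (blk π i) i (blk-blk vπ i)) (blk≤ vσ (blk π i))
  same : ∀ {a b} → (a ≡ true → b ≡ true) → (b ≡ true → a ≡ true) → a ≡ b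
  same {true}  f g = sym (f refl)
  same {false} {true}  f g = g refl
  same {false} {false} f g = refl

≡LP⇒≡ : {σ π : LP n} → σ ≡LP π ≡ true → σ ≡ π
≡LP⇒≡ {σ = σ} {π} h = LP-ext
  (λ i → does⇒ (_ Fin.≟ _) (proj₁ (∧-true⁻ (h′ i))))
  (λ i → boolEq⇒≡ (proj₂ (∧-true⁻ {blk σ i ≟ᶠ blk π i} (h′ i))))
  where h′ = all-tabulate⁻ _ id h

≡LP-refl : (σ : LP n) → σ ≡LP σ ≡ true
≡LP-refl σ = all-tabulate⁺ _ id λ i →
  cong₂ _∧_ (dec-true (blk σ i Fin.≟ blk σ i) refl) (≡⇒boolEq {lab σ i} refl)

concatMap-unique : {f : A → List B} {xs : List A} → Unique xs → (∀ x → Unique (f x)) →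
                   (∀ {x x′ y} → y ∈ f x → y ∈ f x′ → x ≡ x′) → Unique (concatMap f xs)
concatMap-unique []       uf disj = []
concatMap-unique {f = f} {xs = x ∷ xs} (x∉ ∷ u) uf disj =
  Unique.++⁺ (uf x) (concatMap-unique u uf disj)
    λ (y∈fx , y∈rest) → let x′ , x′∈ , y∈fx′ = find (∈-concatMap⁻ f {xs = xs} y∈rest)
                        in All.lookup x∉ x′∈ (disj y∈fx y∈fx′)

allVecs-unique : {xs : List A} → Unique xs → (m : ℕ) → Unique (allVecs xs m)
allVecs-unique u zero    = [] ∷ []
allVecs-unique {xs = xs} u (suc m) = concatMap-unique u
  (λ x → Unique.map⁺ Vec.∷-injectiveʳ (allVecs-unique u m))
  (λ {x} {x′} y∈ y∈′ → let _ , _ , eq = ∈-map⁻ (x ∷_) y∈ ; _ , _ , eq′ = ∈-map⁻ (x′ ∷_) y∈′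
                       in Vec.∷-injectiveˡ (≡.trans (sym eq) eq′))

∈-allVecs : {xs : List A} → (∀ x → x ∈ xs) → ∀ {m} (v : Vec A m) → v ∈ allVecs xs m
∈-allVecs h []      = here refl
∈-allVecs h (x ∷ v) = ∈-concatMap⁺ _ (lose (h x) (∈-map⁺ (x ∷_) (∈-allVecs h v)))

∈-Bools : ∀ b → b ∈ true ∷ false ∷ []
∈-Bools true  = here refl
∈-Bools false = there (here refl)

Bools-unique : Unique (true ∷ false ∷ [])
Bools-unique = ((λ ()) ∷ []) ∷ [] ∷ []

candidates : (n : ℕ) → List (LP n)
candidates n = concatMap (λ f → map (f ,_) (allVecs (true ∷ false ∷ []) n)) (allVecs (allFin n) n)

∈-Πl⁻ : {σ : LP n} → σ ∈ Πl n → Valid σ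
∈-Πl⁻ {n} {σ} σ∈ = valid⁻ σ (proj₂ (∈-filterᵇ⁻ valid {xs = candidates n} σ∈))

∈-Πl⁺ : {σ : LP n} → Valid σ → σ ∈ Πl n
∈-Πl⁺ {σ = σ} v = ∈-filterᵇ⁺ valid
  (∈-concatMap⁺ _ (lose (∈-allVecs ∈-allFin (proj₁ σ)) (∈-map⁺ (proj₁ σ ,_) (∈-allVecs ∈-Bools (proj₂ σ)))))
  (valid⁺ σ v)

Πl-unique : (n : ℕ) → Unique (Πl n)
Πl-unique n = Unique.filter⁺ _ (concatMap-unique (allVecs-unique (Unique.allFin⁺ n) n)
  (λ f → Unique.map⁺ ,-injectiveʳ (allVecs-unique Bools-unique n))
  (λ {f} {f′} y∈ y∈′ → let _ , _ , eq = ∈-map⁻ (f ,_) y∈ ; _ , _ , eq′ = ∈-map⁻ (f′ ,_) y∈′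
                       in ,-injectiveˡ (≡.trans (sym eq) eq′)))

-- Building the upper set of π element by element

-- The pair attached to an element: the least element of its block and the label of that block.
Cell : Set
Cell = ℕ × Bool

-- Relative to π, an element is either the least one of its block, or has the
-- smaller element q as the least one of its block.
data Tag : Set where
  old : (q : ℕ) → Tag
  new : (labelled : Bool) → Tag

-- Data on `Fin n` become functions on ℕ, so that prefixes of all lengths are indexed alike; the
-- sums and codes look only below n.
extend : A → (Fin n → A) → ℕ → A
extend {n = zero}  d f j       = d
extend {n = suc n} d f zero    = f zero
extend {n = suc n} d f (suc j) = extend d (f ∘ suc) j

extend-toℕ : (d : A) (f : Fin n → A) (i : Fin n) → extend d f (toℕ i) ≡ f i
extend-toℕ d f zero    = refl
extend-toℕ d f (suc i) = extend-toℕ d (f ∘ suc) i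

extend-elim : (P : ℕ → A → Set) {d : A} {f : Fin n → A} →
              (∀ i → P (toℕ i) (f i)) → (∀ j → P j d) → ∀ j → P j (extend d f j)
extend-elim {n = zero}  P pf pd j       = pd j
extend-elim {n = suc n} P pf pd zero    = pf zero
extend-elim {n = suc n} P pf pd (suc j) = extend-elim (P ∘ suc) (pf ∘ suc) (pd ∘ suc) j

all-below : (P : ℕ → Set) → (∀ (i : Fin n) → P (toℕ i)) → ∀ {j} → j < n → P j
all-below P h j<n = subst P (Fin.toℕ-fromℕ< j<n) (h (fromℕ< j<n))

-- Vectors list the cells of the elements i-1, …, 0 in this order.
get : ∀ {i} → Vec Cell i → ℕ → Cell
get []                j = 0 , false
get {suc i} (x ∷ p) j = if does (j ℕ.≟ i) then x else get p j

build : (ℕ → Cell) → (i : ℕ) → Vec Cell i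
build g zero    = []
build g (suc i) = g i ∷ build g i

get-head : ∀ {i} (x : Cell) (p : Vec Cell i) → get (x ∷ p) i ≡ x
get-head {i} x p rewrite dec-true (i ℕ.≟ i) refl = refl

get-tail : ∀ {i j} (x : Cell) (p : Vec Cell i) → j < i → get (x ∷ p) j ≡ get p j
get-tail {i} {j} x p j<i rewrite dec-false (j ℕ.≟ i) (ℕ.<⇒≢ j<i) = refl

below-suc : ∀ {i} (P : ℕ → Set) → P i → (∀ {j} → j < i → P j) → ∀ {j} → j < suc i → P j
below-suc {i} P pi p< {j} (s≤s j≤i) with ℕ.m≤n⇒m<n∨m≡n j≤i
... | inj₁ j<i  = p< j<i
... | inj₂ refl = pi

get-build : ∀ g i {j} → j < i → get (build g i) j ≡ g j
get-build g (suc i) = below-suc (λ j → get (build g (suc i)) j ≡ g j)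
  (get-head (g i) (build g i))
  (λ j<i → ≡.trans (get-tail (g i) (build g i) j<i) (get-build g i j<i))

build-cong : ∀ {g g′} i → (∀ {j} → j < i → g j ≡ g′ j) → build g i ≡ build g′ i
build-cong zero    eq = refl
build-cong (suc i) eq = cong₂ _∷_ (eq ℕ.≤-refl) (build-cong i (λ j<i → eq (ℕ.m<n⇒m<1+n j<i)))

build-get : ∀ {i} (p : Vec Cell i) → build (get p) i ≡ p
build-get []      = refl
build-get (x ∷ p) = cong₂ _∷_ (get-head x p)
  (≡.trans (build-cong _ (get-tail x p)) (build-get p))

-- One cell per block of the prefix, contributed by the least element. These are the blocks that a
-- later element can join, and counting them counts blocks.
reps : ∀ {i} → Vec Cell i → List Cell
reps []              = []
reps {suc i} (x ∷ p) = if does (proj₁ x ℕ.≟ i) then x ∷ reps p else reps p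

∈-reps⁻ : ∀ {i} (p : Vec Cell i) {x} → x ∈ reps p → proj₁ x < i × get p (proj₁ x) ≡ x
∈-reps⁻ {suc i} (y ∷ p) x∈ with does (proj₁ y ℕ.≟ i) in eq
∈-reps⁻ {suc i} (y ∷ p) (here refl) | true with refl ← does⇒ (proj₁ y ℕ.≟ i) eq
  = ℕ.≤-refl , get-head y p
∈-reps⁻ {suc i} (y ∷ p) (there x∈)  | true with x<i , e ← ∈-reps⁻ p x∈
  = ℕ.m<n⇒m<1+n x<i , ≡.trans (get-tail y p x<i) e
∈-reps⁻ {suc i} (y ∷ p) x∈          | false with x<i , e ← ∈-reps⁻ p x∈
  = ℕ.m<n⇒m<1+n x<i , ≡.trans (get-tail y p x<i) e

∈-reps⁺ : ∀ {i} (p : Vec Cell i) {x} → proj₁ x < i → get p (proj₁ x) ≡ x → x ∈ reps p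
∈-reps⁺ {suc i} (y ∷ p) {x} (s≤s x≤i) eq with ℕ.m≤n⇒m<n∨m≡n x≤i
... | inj₂ refl with refl ← ≡.trans (sym (get-head y p)) eq
  rewrite dec-true (i ℕ.≟ i) refl = here refl
... | inj₁ x<i with x∈ ← ∈-reps⁺ p x<i (≡.trans (sym (get-tail y p x<i)) eq)
  with does (proj₁ y ℕ.≟ i)
...   | true  = there x∈
...   | false = x∈

reps-unique : ∀ {i} (p : Vec Cell i) → Unique (reps p)
reps-unique []              = []
reps-unique {suc i} (x ∷ p) with does (proj₁ x ℕ.≟ i) in eq
... | false = reps-unique p
... | true  = All.tabulate (λ y∈ e → ℕ.<-irrefl (≡.trans (cong proj₁ (sym e)) (does⇒ (proj₁ x ℕ.≟ i) eq))
                                                (proj₁ (∈-reps⁻ p y∈))) ∷ reps-unique p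

-- A block of σ receives its label with its least element and keeps it. Hence the least element of a
-- labelled block of π may join only labelled blocks, and that of an unlabelled one may join any.
choices : ∀ {i} → Tag → Vec Cell i → List Cell
choices     (old q)     p = [ get p q ]
choices {i} (new true)  p = (i , true) ∷ filterᵇ proj₂ (reps p)
choices {i} (new false) p = (i , true) ∷ (i , false) ∷ reps p

enum : (ℕ → Tag) → (i : ℕ) → List (Vec Cell i)
enum τ zero    = [ [] ]
enum τ (suc i) = concatMap (λ p → map (_∷ p) (choices (τ i) p)) (enum τ i)

choices-unique : ∀ {i} t (p : Vec Cell i) → Unique (choices t p)
choices-unique (old q) p = [] ∷ []
choices-unique (new true) p =
  All.tabulate (λ y∈ eq → ℕ.<-irrefl (cong proj₁ (sym eq))
    (proj₁ (∈-reps⁻ p (proj₁ (∈-filterᵇ⁻ proj₂ {xs = reps p} y∈)))))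
  ∷ Unique.filter⁺ (T? ∘ proj₂) (reps-unique p)
choices-unique (new false) p = ((λ ()) ∷ fresh true) ∷ fresh false ∷ reps-unique p
  where
  fresh : ∀ b → All.All ((_ , b) ≢_) (reps p)
  fresh b = All.tabulate (λ y∈ eq → ℕ.<-irrefl (cong proj₁ (sym eq)) (proj₁ (∈-reps⁻ p y∈)))

enum-unique : ∀ τ i → Unique (enum τ i)
enum-unique τ zero    = [] ∷ []
enum-unique τ (suc i) = concatMap-unique (enum-unique τ i)
  (λ p → Unique.map⁺ Vec.∷-injectiveˡ (choices-unique (τ i) p))
  (λ {p} {p′} y∈ y∈′ → let _ , _ , eq = ∈-map⁻ (_∷ p) y∈ ; _ , _ , eq′ = ∈-map⁻ (_∷ p′) y∈′
                       in Vec.∷-injectiveʳ (≡.trans (sym eq) eq′))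

-- `choices` restated for a cell function. For a well-formed tag only values of g below i are
-- consulted, so a prefix and the whole function satisfy it together.
Admissible : ℕ → Tag → (ℕ → Cell) → Cell → Set
Admissible i (old q) g x = x ≡ g q
Admissible i (new t) g x =
  (t ≡ true → proj₂ x ≡ true) × (proj₁ x ≡ i ⊎ (proj₁ x < i × g (proj₁ x) ≡ x))

WellFormed : ℕ → Tag → Set
WellFormed i (old q) = q < i
WellFormed i (new _) = ⊤

Admissible-cong : ∀ {i t g g′ x} → WellFormed i t → (∀ {j} → j < i → g j ≡ g′ j) →
                  Admissible i t g x → Admissible i t g′ x
Admissible-cong {t = old q} q<i eq a                   = ≡.trans a (eq q<i)
Admissible-cong {t = new _} _   eq (l , inj₁ e)        = l , inj₁ e
Admissible-cong {t = new _} _   eq (l , inj₂ (x< , e)) = l , inj₂ (x< , ≡.trans (sym (eq x<)) e)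

∈-choices⁻ : ∀ {i} t (p : Vec Cell i) {x} → x ∈ choices t p → Admissible i t (get p) x
∈-choices⁻ (old q)     p (here refl)         = refl
∈-choices⁻ (new true)  p (here refl)         = id , inj₁ refl
∈-choices⁻ (new true)  p (there x∈)          with x∈ , l ← ∈-filterᵇ⁻ proj₂ {xs = reps p} x∈
  = (λ _ → l) , inj₂ (∈-reps⁻ p x∈)
∈-choices⁻ (new false) p (here refl)         = (λ ()) , inj₁ refl
∈-choices⁻ (new false) p (there (here refl)) = (λ ()) , inj₁ refl
∈-choices⁻ (new false) p (there (there x∈))  = (λ ()) , inj₂ (∈-reps⁻ p x∈)

∈-choices⁺ : ∀ {i} t (p : Vec Cell i) {x} → Admissible i t (get p) x → x ∈ choices t p
∈-choices⁺ (old q)     p refl                              = here refl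
∈-choices⁺ (new true)  p {_ , l} (lt , inj₁ refl) with refl ← lt refl = here refl
∈-choices⁺ (new true)  p (lt , inj₂ (x< , e))              = there (∈-filterᵇ⁺ proj₂ (∈-reps⁺ p x< e) (lt refl))
∈-choices⁺ (new false) p {_ , true}  (_ , inj₁ refl)       = here refl
∈-choices⁺ (new false) p {_ , false} (_ , inj₁ refl)       = there (here refl)
∈-choices⁺ (new false) p (_ , inj₂ (x< , e))               = there (there (∈-reps⁺ p x< e))

module _ {τ : ℕ → Tag} (wf : ∀ j → WellFormed j (τ j)) where

  ∈-enum⁻ : ∀ {i} (p : Vec Cell i) → p ∈ enum τ i → ∀ {j} → j < i → Admissible j (τ j) (get p) (get p j)
  ∈-enum⁻ {zero}  []      _  ()
  ∈-enum⁻ {suc i} xp xp∈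
    with p , p∈ , q ← find (∈-concatMap⁻ (λ p → map (_∷ p) (choices (τ i) p)) {xs = enum τ i} xp∈)
    with x , x∈ , refl ← ∈-map⁻ (_∷ p) q
    = below-suc (λ j → Admissible j (τ j) (get (x ∷ p)) (get (x ∷ p) j))
        (subst (Admissible i (τ i) _) (sym (get-head x p))
          (Admissible-cong (wf i) (sym ∘ get-tail x p) (∈-choices⁻ (τ i) p x∈)))
        (λ {j} j<i → subst (Admissible j (τ j) _) (sym (get-tail x p j<i))
          (Admissible-cong (wf j) (λ k<j → sym (get-tail x p (ℕ.<-trans k<j j<i))) (∈-enum⁻ p p∈ j<i)))

  ∈-enum⁺ : ∀ {i} (p : Vec Cell i) → (∀ {j} → j < i → Admissible j (τ j) (get p) (get p j)) → p ∈ enum τ i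
  ∈-enum⁺ []      h = here refl
  ∈-enum⁺ {suc i} (x ∷ p) h = ∈-concatMap⁺ _ (lose
    (∈-enum⁺ p λ {j} j<i → subst (Admissible j (τ j) _) (get-tail x p j<i)
      (Admissible-cong (wf j) (λ k<j → get-tail x p (ℕ.<-trans k<j j<i)) (h (ℕ.m<n⇒m<1+n j<i))))
    (∈-map⁺ (_∷ p) (∈-choices⁺ (τ i) p
      (subst (Admissible i (τ i) _) (get-head x p) (Admissible-cong (wf i) (get-tail x p) (h ℕ.≤-refl))))))

  -- An `old` cell copies the cell at an earlier q, so the bound at q serves, by strong induction.
  -- The bound lets a code be read back as a vector over `Fin n`, and shows that an `old` element
  -- starts no block.
  Admissible-≤ : ∀ {i} g → (∀ {j} → j < i → Admissible j (τ j) g (g j)) → ∀ {j} → j < i → proj₁ (g j) ≤ j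
  Admissible-≤ {i} g h {j} = <-rec (λ j → j < i → proj₁ (g j) ≤ j) step j
    where
    step : ∀ j → (∀ {k} → k < j → k < i → proj₁ (g k) ≤ k) → j < i → proj₁ (g j) ≤ j
    step j ih j<i with τ j | wf j | h j<i
    ... | old q | q<j | eq = ℕ.≤-trans (ℕ.≤-reflexive (cong proj₁ eq))
                               (ℕ.≤-trans (ih q<j (ℕ.<-trans q<j j<i)) (ℕ.<⇒≤ q<j))
    ... | new _ | _ | _ , inj₁ eq       = ℕ.≤-reflexive eq
    ... | new _ | _ | _ , inj₂ (x< , _) = ℕ.<⇒≤ x<

-- The upper set of π corresponds to the enumerated codes

cell : LP n → Fin n → Cell
cell σ i = toℕ (blk σ i) , lab σ i

cells : LP n → ℕ → Cell
cells σ = extend (0 , false) (cell σ)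

tag : LP n → Fin n → Tag
tag π i = if blk π i ≟ᶠ i then new (lab π i) else old (toℕ (blk π i))

-- The default `new false` is well formed at every index, so well-formedness holds on all of ℕ.
tags : LP n → ℕ → Tag
tags π = extend (new false) (tag π)

code : LP n → Vec Cell n
code {n} σ = build (cells σ) n

cells-toℕ : (σ : LP n) (i : Fin n) → cells σ (toℕ i) ≡ cell σ i
cells-toℕ σ = extend-toℕ _ (cell σ)

tags-wellFormed : {π : LP n} → Valid π → ∀ j → WellFormed j (tags π j)
tags-wellFormed {π = π} v = extend-elim WellFormed wf (λ _ → tt)
  where
  wf : ∀ i → WellFormed (toℕ i) (tag π i)
  wf i with blk π i Fin.≟ i
  ... | yes _  = tt
  ... | no  ≢i = ℕ.≤∧≢⇒< (blk≤ v i) (≢i ∘ Fin.toℕ-injective)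

cell-injective : {σ : LP n} {i j : Fin n} → cell σ i ≡ cell σ j → blk σ i ≡ blk σ j × lab σ i ≡ lab σ j
cell-injective eq = Fin.toℕ-injective (cong proj₁ eq) , cong proj₂ eq

module _ {π σ : LP n} (vπ : Valid π) where

  refinement⇒admissible : Valid σ → π ≼ σ →
    ∀ i → Admissible (toℕ i) (tag π i) (cells σ) (cell σ i)
  refinement⇒admissible vσ π≼σ i with blk π i Fin.≟ i
  ... | yes _ = lab-mono π≼σ i , position
    where
    position : toℕ (blk σ i) ≡ toℕ i ⊎ (toℕ (blk σ i) < toℕ i × cells σ (toℕ (blk σ i)) ≡ cell σ i)
    position with ℕ.m≤n⇒m<n∨m≡n (blk≤ vσ i)
    ... | inj₂ eq = inj₁ eq
    ... | inj₁ lt = inj₂ (lt , ≡.trans (cells-toℕ σ (blk σ i))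
                       (cong₂ _,_ (cong toℕ (blk-blk vσ i)) (sym (lab-blk vσ i))))
  ... | no _ = ≡.trans (cong₂ _,_ (cong toℕ same-blk) same-lab) (sym (cells-toℕ σ (blk π i)))
    where
    same-blk : blk σ i ≡ blk σ (blk π i)
    same-blk = blk-mono π≼σ i (blk π i) (sym (blk-blk vπ i))
    same-lab : lab σ i ≡ lab σ (blk π i)
    same-lab = ≡.trans (lab-blk vσ i) (≡.trans (cong (lab σ) same-blk) (sym (lab-blk vσ (blk π i))))

  module _ (h : ∀ i → Admissible (toℕ i) (tag π i) (cells σ) (cell σ i)) where

    -- Reduces validity of σ and π ≼ σ to the least elements of the blocks of π, where `at-min`
    -- supplies what is needed.
    follows : ∀ i → cell σ i ≡ cell σ (blk π i)
    follows i with blk π i Fin.≟ i | h i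
    ... | yes eq | _ = cong (cell σ) (sym eq)
    ... | no _   | e = ≡.trans e (cells-toℕ σ (blk π i))

    at-min : ∀ i → blk π i ≡ i → (lab π i ≡ true → lab σ i ≡ true) ×
             toℕ (blk σ i) ≤ toℕ i × cell σ (blk σ i) ≡ cell σ i
    at-min i eq with blk π i Fin.≟ i | h i
    ... | no ≢i | _                   = contradiction eq ≢i
    ... | yes _ | l , inj₁ e          = l , ℕ.≤-reflexive e , cong (cell σ) (Fin.toℕ-injective e)
    ... | yes _ | l , inj₂ (lt , e)   = l , ℕ.<⇒≤ lt , ≡.trans (sym (cells-toℕ σ (blk σ i))) e

    follows-blk : ∀ i → blk σ i ≡ blk σ (blk π i)
    follows-blk i = proj₁ (cell-injective {σ = σ} {i} {blk π i} (follows i))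

    follows-lab : ∀ i → lab σ i ≡ lab σ (blk π i)
    follows-lab i = proj₂ (cell-injective {σ = σ} {i} {blk π i} (follows i))

    cell-blk : ∀ i → cell σ (blk σ i) ≡ cell σ i
    cell-blk i = begin
      cell σ (blk σ i)          ≡⟨ cong (cell σ) (follows-blk i) ⟩
      cell σ (blk σ (blk π i))  ≡⟨ proj₂ (proj₂ (at-min (blk π i) (blk-blk vπ i))) ⟩
      cell σ (blk π i)          ≡⟨ follows i ⟨
      cell σ i                  ∎
      where open ≡-Reasoning

    admissible⇒valid : Valid σ
    admissible⇒valid = mkValid
      (λ i → ℕ.≤-trans (ℕ.≤-reflexive (cong toℕ (follows-blk i)))
               (ℕ.≤-trans (proj₁ (proj₂ (at-min (blk π i) (blk-blk vπ i)))) (blk≤ vπ i)))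
      (λ i → proj₁ (cell-injective {σ = σ} {blk σ i} {i} (cell-blk i)))
      (λ i → sym (proj₂ (cell-injective {σ = σ} {blk σ i} {i} (cell-blk i))))

    admissible⇒≼ : π ≼ σ
    admissible⇒≼ = mk≼
      (λ i j eq → ≡.trans (follows-blk i) (≡.trans (cong (blk σ) eq) (sym (follows-blk j))))
      (λ i l → ≡.trans (follows-lab i)
        (proj₁ (at-min (blk π i) (blk-blk vπ i)) (≡.trans (sym (lab-blk vπ i)) l)))

code-injective : {σ σ′ : LP n} → code σ ≡ code σ′ → σ ≡ σ′
code-injective {n} {σ} {σ′} eq = LP-ext
  (λ i → Fin.toℕ-injective (cong proj₁ (same i))) (λ i → cong proj₂ (same i))
  where
  same : ∀ i → cell σ i ≡ cell σ′ i
  same i = begin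
    cell σ i                  ≡⟨ cells-toℕ σ i ⟨
    cells σ (toℕ i)           ≡⟨ get-build (cells σ) n (Fin.toℕ<n i) ⟨
    get (code σ) (toℕ i)      ≡⟨ cong (λ p → get p (toℕ i)) eq ⟩
    get (code σ′) (toℕ i)     ≡⟨ get-build (cells σ′) n (Fin.toℕ<n i) ⟩
    cells σ′ (toℕ i)          ≡⟨ cells-toℕ σ′ i ⟩
    cell σ′ i                 ∎
    where open ≡-Reasoning

realise : (g : ℕ → Cell) → (∀ {j} → j < n → proj₁ (g j) ≤ j) → LP n
realise g g≤ = Vec.tabulate (λ i → fromℕ< (ℕ.≤-<-trans (g≤ (Fin.toℕ<n i)) (Fin.toℕ<n i)))
             , Vec.tabulate (λ i → proj₂ (g (toℕ i)))

cell-realise : ∀ g (g≤ : ∀ {j} → j < n → proj₁ (g j) ≤ j) i → cell (realise g g≤) i ≡ g (toℕ i)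
cell-realise g g≤ i = cong₂ _,_
  (≡.trans (cong toℕ (Vec.lookup∘tabulate _ i)) (Fin.toℕ-fromℕ< _)) (Vec.lookup∘tabulate _ i)

module _ {π : LP n} (vπ : Valid π) where

  private wf = tags-wellFormed vπ

  -- Neither list has repetitions, so equality of their sets of members suffices, and their orders
  -- need not be compared.
  codes-of-upper-set : map code (filterᵇ (π ≤LP_) (Πl n)) ↭ enum (tags π) n
  codes-of-upper-set = ∼bag⇒↭ (unique∧set⇒bag
    (Unique.map⁺ code-injective (Unique.filter⁺ _ (Πl-unique n)))
    (enum-unique (tags π) n) (mk⇔ to from))
    where
    to : ∀ {p} → p ∈ map code (filterᵇ (π ≤LP_) (Πl n)) → p ∈ enum (tags π) n
    to p∈ with σ , σ∈ , refl ← ∈-map⁻ code p∈ with σ∈Π , π≤σ ← ∈-filterᵇ⁻ (π ≤LP_) {xs = Πl n} σ∈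
      = ∈-enum⁺ wf (code σ) λ {j} j<n → subst (Admissible j (tags π j) _) (sym (get-build (cells σ) n j<n))
          (Admissible-cong (wf j) (λ k<j → sym (get-build (cells σ) n (ℕ.<-trans k<j j<n)))
            (all-below (λ j → Admissible j (tags π j) (cells σ) (cells σ j)) adm j<n))
      where
      adm : ∀ i → Admissible (toℕ i) (tags π (toℕ i)) (cells σ) (cells σ (toℕ i))
      adm i rewrite extend-toℕ (new false) (tag π) i | cells-toℕ σ i =
        refinement⇒admissible vπ (∈-Πl⁻ σ∈Π) (≤LP⁻ π σ π≤σ) i

    from : ∀ {p} → p ∈ enum (tags π) n → p ∈ map code (filterᵇ (π ≤LP_) (Πl n))
    from {p} p∈ = subst (_∈ _) code-σ (∈-map⁺ code (∈-filterᵇ⁺ (π ≤LP_) {xs = Πl n}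
      (∈-Πl⁺ (admissible⇒valid {σ = σ} vπ adm)) (≤LP⁺ π σ (admissible⇒≼ {σ = σ} vπ adm))))
      where
      ok : ∀ {j} → j < n → Admissible j (tags π j) (get p) (get p j)
      ok = ∈-enum⁻ wf p p∈
      σ : LP n
      σ = realise (get p) (Admissible-≤ wf (get p) ok)
      cell-σ : ∀ i → cell σ i ≡ get p (toℕ i)
      cell-σ = cell-realise (get p) (Admissible-≤ wf (get p) ok)
      cells-σ : ∀ {j} → j < n → cells σ j ≡ get p j
      cells-σ = all-below (λ j → cells σ j ≡ get p j) λ i → ≡.trans (cells-toℕ σ i) (cell-σ i)
      code-σ : code σ ≡ p
      code-σ = ≡.trans (build-cong n cells-σ) (build-get p)
      adm : ∀ i → Admissible (toℕ i) (tag π i) (cells σ) (cell σ i)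
      adm i = subst (Admissible (toℕ i) (tag π i) (cells σ)) (sym (cell-σ i))
        (subst (λ t → Admissible (toℕ i) t (cells σ) (get p (toℕ i))) (extend-toℕ (new false) (tag π) i)
          (Admissible-cong (wf (toℕ i)) (λ k<i → sym (cells-σ (ℕ.<-trans k<i (Fin.toℕ<n i))))
            (ok (Fin.toℕ<n i))))

-- Summation over the upper set

-- The arguments are the numbers of unlabelled and of labelled blocks. Equal values at 0 and 1
-- unlabelled blocks are what makes this shape stable under insertion.
weight : (ℕ → ℤ) → ℕ → ℕ → ℤ
weight w zero          b = w b
weight w (suc zero)    b = w b
weight w (suc (suc a)) b = 0ℤ

weight-T : ∀ w a b → weight w a (suc b) +ℤ pos b *ℤ weight w a b ≡ weight (T w) a b
weight-T w zero          b = ℤ.+-comm (w (suc b)) _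
weight-T w (suc zero)    b = ℤ.+-comm (w (suc b)) _
weight-T w (suc (suc a)) b = ≡.trans (ℤ.+-identityˡ _) (ℤ.*-zeroʳ (pos b))

-- The summand that F adds to T arises for a = 0 by opening the unlabelled block and for a = 1 by
-- joining it; opening a second one has weight 0.
weight-F : ∀ w a b → weight w a (suc b) +ℤ (weight w (suc a) b +ℤ pos (a + b) *ℤ weight w a b)
                     ≡ weight (F w) a b
weight-F w zero b = lemma (pos b) (w b) (w (suc b))
  where
  lemma : ∀ b x y → y +ℤ (x +ℤ b *ℤ x) ≡ (b *ℤ x +ℤ y) +ℤ x
  lemma = ℤ-Solver.solve-∀
weight-F w (suc zero) b = ≡.trans
  (cong (λ c → w (suc b) +ℤ (0ℤ +ℤ c *ℤ w b)) (ℤ.pos-+ 1 b)) (lemma (pos b) (w b) (w (suc b)))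
  where
  lemma : ∀ b x y → y +ℤ (0ℤ +ℤ (1ℤ +ℤ b) *ℤ x) ≡ (b *ℤ x +ℤ y) +ℤ x
  lemma = ℤ-Solver.solve-∀
weight-F w (suc (suc a)) b =
  ≡.trans (ℤ.+-identityˡ _) (≡.trans (ℤ.+-identityˡ _) (ℤ.*-zeroʳ (pos (suc (suc a) + b))))

Σ-const : (xs : List A) (c : ℤ) → Σ xs (λ _ → c) ≡ pos (length xs) *ℤ c
Σ-const []       c = refl
Σ-const (x ∷ xs) c = ≡.trans (cong (c +ℤ_) (Σ-const xs c)) (sym (ℤ.suc-* (pos (length xs)) c))

countᵇ-not : (p : A → Bool) (xs : List A) → countᵇ (not ∘ p) xs + countᵇ p xs ≡ length xs
countᵇ-not p []       = refl
countᵇ-not p (x ∷ xs) with p x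
... | true  = ≡.trans (ℕ.+-suc _ _) (cong suc (countᵇ-not p xs))
... | false = cong suc (countᵇ-not p xs)

pos-countᵇ : (p : A → Bool) (xs : List A) → pos (countᵇ p xs) ≡ Σ xs (λ x → if p x then 1ℤ else 0ℤ)
pos-countᵇ p []       = refl
pos-countᵇ p (x ∷ xs) with p x
... | true  = ≡.trans (ℤ.pos-+ 1 (countᵇ p xs)) (cong (1ℤ +ℤ_) (pos-countᵇ p xs))
... | false = ≡.trans (pos-countᵇ p xs) (sym (ℤ.+-identityˡ _))

labelledReps : ∀ {i} → Vec Cell i → ℕ
labelledReps p = countᵇ proj₂ (reps p)

unlabelledReps : ∀ {i} → Vec Cell i → ℕ
unlabelledReps p = countᵇ (not ∘ proj₂) (reps p)

codeWeight : (ℕ → ℤ) → ∀ {i} → Vec Cell i → ℤ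
codeWeight w p = weight w (unlabelledReps p) (labelledReps p)

reps-new : ∀ {i} l (p : Vec Cell i) → reps ((i , l) ∷ p) ≡ (i , l) ∷ reps p
reps-new {i} l p rewrite dec-true (i ℕ.≟ i) refl = refl

reps-old : ∀ {i} x (p : Vec Cell i) → proj₁ x < i → reps (x ∷ p) ≡ reps p
reps-old {i} x p x<i rewrite dec-false (proj₁ x ℕ.≟ i) (ℕ.<⇒≢ x<i) = refl

codeWeight-old : ∀ w {i} x (p : Vec Cell i) → proj₁ x < i → codeWeight w (x ∷ p) ≡ codeWeight w p
codeWeight-old w x p x<i rewrite reps-old x p x<i = refl

codeWeight-labelled : ∀ w {i} (p : Vec Cell i) →
  codeWeight w ((i , true) ∷ p) ≡ weight w (unlabelledReps p) (suc (labelledReps p))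
codeWeight-labelled w p rewrite reps-new true p = refl

codeWeight-unlabelled : ∀ w {i} (p : Vec Cell i) →
  codeWeight w ((i , false) ∷ p) ≡ weight w (suc (unlabelledReps p)) (labelledReps p)
codeWeight-unlabelled w p rewrite reps-new false p = refl

insert : Tag → (ℕ → ℤ) → ℕ → ℤ
insert (old _)     w = w
insert (new true)  w = T w
insert (new false) w = F w

-- A cell changes the block counts only if it points at its own position i. Every joining cell
-- points below i, so the joins contribute equal weights and are merely counted.
Σ-choices : ∀ w {i} t (p : Vec Cell i) → (∀ {q} → t ≡ old q → proj₁ (get p q) < i) →
            Σ (choices t p) (λ x → codeWeight w (x ∷ p)) ≡ codeWeight (insert t w) p
Σ-choices w (old q) p q< = ≡.trans (ℤ.+-identityʳ _) (codeWeight-old w (get p q) p (q< refl))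
Σ-choices w {i} (new true) p _ = begin
  codeWeight w ((i , true) ∷ p) +ℤ Σ (filterᵇ proj₂ (reps p)) (λ x → codeWeight w (x ∷ p))
    ≡⟨ cong₂ _+ℤ_ (codeWeight-labelled w p)
         (≡.trans (Σ-cong (filterᵇ proj₂ (reps p)) λ {x} x∈ →
           codeWeight-old w x p (proj₁ (∈-reps⁻ p (proj₁ (∈-filterᵇ⁻ proj₂ {xs = reps p} x∈)))))
         (Σ-const (filterᵇ proj₂ (reps p)) (codeWeight w p))) ⟩
  weight w a (suc b) +ℤ pos b *ℤ weight w a b
    ≡⟨ weight-T w a b ⟩
  weight (T w) a b ∎
  where
  open ≡-Reasoning
  a = unlabelledReps p
  b = labelledReps p
Σ-choices w {i} (new false) p _ = begin
  codeWeight w ((i , true) ∷ p) +ℤ (codeWeight w ((i , false) ∷ p) +ℤ Σ (reps p) (λ x → codeWeight w (x ∷ p)))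
    ≡⟨ cong₂ _+ℤ_ (codeWeight-labelled w p) (cong₂ _+ℤ_ (codeWeight-unlabelled w p)
         (≡.trans (Σ-cong (reps p) λ {x} x∈ → codeWeight-old w x p (proj₁ (∈-reps⁻ p x∈)))
         (Σ-const (reps p) (codeWeight w p)))) ⟩
  weight w a (suc b) +ℤ (weight w (suc a) b +ℤ pos (length (reps p)) *ℤ weight w a b)
    ≡⟨ cong (λ m → weight w a (suc b) +ℤ (weight w (suc a) b +ℤ pos m *ℤ weight w a b))
         (sym (countᵇ-not proj₂ (reps p))) ⟩
  weight w a (suc b) +ℤ (weight w (suc a) b +ℤ pos (a + b) *ℤ weight w a b)
    ≡⟨ weight-F w a b ⟩
  weight (F w) a b ∎
  where
  open ≡-Reasoning
  a = unlabelledReps p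
  b = labelledReps p

countBelow : (ℕ → Bool) → ℕ → ℕ
countBelow p zero    = 0
countBelow p (suc i) = if p i then suc (countBelow p i) else countBelow p i

isLabelled isUnlabelled : Tag → Bool
isLabelled (new t) = t
isLabelled (old _) = false
isUnlabelled (new t) = not t
isUnlabelled (old _) = false

-- Summing over the cell of the last element replaces w by `insert (τ i) w` on shorter prefixes. The
-- empty prefix has no blocks, hence the evaluation at 0.
Σ-enum : ∀ {τ} → (∀ j → WellFormed j (τ j)) → ∀ i w →
         Σ (enum τ i) (codeWeight w)
         ≡ iterate F (iterate T w (countBelow (isLabelled ∘ τ) i)) (countBelow (isUnlabelled ∘ τ) i) 0
Σ-enum wf zero w = ℤ.+-identityʳ _
Σ-enum {τ} wf (suc i) w = begin
  Σ (enum τ (suc i)) (codeWeight w)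
    ≡⟨ Σ-concatMap (λ p → map (_∷ p) (choices (τ i) p)) (codeWeight w) (enum τ i) ⟩
  Σ (enum τ i) (λ p → Σ (map (_∷ p) (choices (τ i) p)) (codeWeight w))
    ≡⟨ Σ-cong (enum τ i) (λ {p} p∈ → ≡.trans (Σ-map (_∷ p) (codeWeight w) (choices (τ i) p))
         (Σ-choices w (τ i) p (old< p p∈))) ⟩
  Σ (enum τ i) (codeWeight (insert (τ i) w))
    ≡⟨ Σ-enum wf i (insert (τ i) w) ⟩
  iterate F (iterate T (insert (τ i) w) (countBelow (isLabelled ∘ τ) i)) (countBelow (isUnlabelled ∘ τ) i) 0
    ≡⟨ commute ⟩
  iterate F (iterate T w (countBelow (isLabelled ∘ τ) (suc i))) (countBelow (isUnlabelled ∘ τ) (suc i)) 0 ∎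
  where
  open ≡-Reasoning
  old< : ∀ p → p ∈ enum τ i → ∀ {q} → τ i ≡ old q → proj₁ (get p q) < i
  old< p p∈ {q} eq = ℕ.≤-<-trans (Admissible-≤ wf (get p) (∈-enum⁻ wf p p∈) q<i) q<i
    where
    q<i : q < i
    q<i = subst (WellFormed i) eq (wf i)
  commute : iterate F (iterate T (insert (τ i) w) (countBelow (isLabelled ∘ τ) i)) (countBelow (isUnlabelled ∘ τ) i) 0
          ≡ iterate F (iterate T w (countBelow (isLabelled ∘ τ) (suc i))) (countBelow (isUnlabelled ∘ τ) (suc i)) 0
  commute with τ i
  ... | old _     = refl
  ... | new true  = refl
  -- Here F acts on w before all the T's and has to be moved past them to join the other F's.
  ... | new false = iterate-cong F-cong (countBelow (isUnlabelled ∘ τ) i)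
    (λ b → sym (iterate-natural F T-cong FT≗TF (countBelow (isLabelled ∘ τ) i) w b)) 0

-- `countBelow` removes the largest index and `tabulate` the smallest; this reconciles the two
-- recursions.
countBelow-suc : ∀ p i → countBelow p (suc i) ≡ (if p 0 then suc (countBelow (p ∘ suc) i) else countBelow (p ∘ suc) i)
countBelow-suc p zero = refl
countBelow-suc p (suc i) rewrite countBelow-suc p i with p 0 | p (suc i)
... | true  | true  = refl
... | true  | false = refl
... | false | true  = refl
... | false | false = refl

countᵇ-tabulate : (p : A → Bool) (h : ℕ → Bool) (f : Fin n → A) →
                  (∀ i → h (toℕ i) ≡ p (f i)) → countBelow h n ≡ countᵇ p (tabulate f)
countᵇ-tabulate {n = zero}  p h f eq = refl
countᵇ-tabulate {n = suc n} p h f eq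
  rewrite countBelow-suc h n | eq zero | countᵇ-tabulate p (h ∘ suc) (f ∘ suc) (eq ∘ suc)
  with p (f zero)
... | true  = refl
... | false = refl

reps-build : ∀ q g i → countᵇ q (reps (build g i))
             ≡ countBelow (λ j → does (proj₁ (g j) ℕ.≟ j) ∧ q (g j)) i
reps-build q g zero = refl
reps-build q g (suc i) with does (proj₁ (g i) ℕ.≟ i)
... | false = reps-build q g i
... | true with q (g i)
...   | true  = cong suc (reps-build q g i)
...   | false = reps-build q g i

numUnlabelled : LP n → ℕ
numUnlabelled π = countᵇ (λ i → (blk π i ≟ᶠ i) ∧ not (lab π i)) (allFin _)

reps-code : (q : Bool → Bool) (σ : LP n) →
  countᵇ (q ∘ proj₂) (reps (code σ)) ≡ countᵇ (λ i → (blk σ i ≟ᶠ i) ∧ q (lab σ i)) (allFin n)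
reps-code {n} q σ = ≡.trans (reps-build (q ∘ proj₂) (cells σ) n)
  (countᵇ-tabulate _ _ id λ i → ≡.trans
    (cong (λ c → does (proj₁ c ℕ.≟ toℕ i) ∧ q (proj₂ c)) (cells-toℕ σ i))
    (cong (_∧ q (lab σ i)) (same-test i)))
  where
  same-test : ∀ i → does (toℕ (blk σ i) ℕ.≟ toℕ i) ≡ (blk σ i ≟ᶠ i)
  same-test i with blk σ i Fin.≟ i
  ... | yes eq = dec-true (_ ℕ.≟ _) (cong toℕ eq)
  ... | no ≢i  = dec-false (_ ℕ.≟ _) (≢i ∘ Fin.toℕ-injective)

tags-labelled : (π : LP n) → countBelow (isLabelled ∘ tags π) n ≡ numLabelled π
tags-labelled π = countᵇ-tabulate _ _ id λ i →
  ≡.trans (cong isLabelled (extend-toℕ (new false) (tag π) i)) (test i)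
  where
  test : ∀ i → isLabelled (tag π i) ≡ (blk π i ≟ᶠ i) ∧ lab π i
  test i with blk π i ≟ᶠ i
  ... | true  = refl
  ... | false = refl

tags-unlabelled : (π : LP n) → countBelow (isUnlabelled ∘ tags π) n ≡ numUnlabelled π
tags-unlabelled π = countᵇ-tabulate _ _ id λ i →
  ≡.trans (cong isUnlabelled (extend-toℕ (new false) (tag π) i)) (test i)
  where
  test : ∀ i → isUnlabelled (tag π i) ≡ (blk π i ≟ᶠ i) ∧ not (lab π i)
  test i with blk π i ≟ᶠ i
  ... | true  = refl
  ... | false = refl

lpWeight : (ℕ → ℤ) → LP n → ℤ
lpWeight w σ = weight w (numUnlabelled σ) (numLabelled σ)

Σ-above : {π : LP n} → Valid π → ∀ w →
  Σ (Πl n) (λ σ → if π ≤LP σ then lpWeight w σ else 0ℤ)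
  ≡ iterate F (iterate T w (numLabelled π)) (numUnlabelled π) 0
Σ-above {n} {π} vπ w = begin
  Σ (Πl n) (λ σ → if π ≤LP σ then lpWeight w σ else 0ℤ)
    ≡⟨ Σ-filterᵇ (π ≤LP_) (lpWeight w) (Πl n) ⟨
  Σ (filterᵇ (π ≤LP_) (Πl n)) (lpWeight w)
    ≡⟨ Σ-cong (filterᵇ (π ≤LP_) (Πl n))
         (λ {σ} _ → cong₂ (weight w) (sym (reps-code not σ)) (sym (reps-code id σ))) ⟩
  Σ (filterᵇ (π ≤LP_) (Πl n)) (codeWeight w ∘ code)
    ≡⟨ Σ-map code (codeWeight w) (filterᵇ (π ≤LP_) (Πl n)) ⟨
  Σ (map code (filterᵇ (π ≤LP_) (Πl n))) (codeWeight w)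
    ≡⟨ Σ-↭ (codeWeight w) (codes-of-upper-set vπ) ⟩
  Σ (enum (tags π) n) (codeWeight w)
    ≡⟨ Σ-enum (tags-wellFormed vπ) n w ⟩
  iterate F (iterate T w (countBelow (isLabelled ∘ tags π) n)) (countBelow (isUnlabelled ∘ tags π) n) 0
    ≡⟨ cong₂ (λ t f → iterate F (iterate T w t) f 0) (tags-labelled π) (tags-unlabelled π) ⟩
  iterate F (iterate T w (numLabelled π)) (numUnlabelled π) 0 ∎
  where open ≡-Reasoning

-- Existence of labelled blocks, and the partition into singletons

unlabelled⇒numLabelled≡0 : (π : LP n) → (∀ i → lab π i ≡ false) → numLabelled π ≡ 0
unlabelled⇒numLabelled≡0 π none = go (allFin _)
  where
  go : ∀ is → countᵇ (λ i → (blk π i ≟ᶠ i) ∧ lab π i) is ≡ 0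
  go []       = refl
  go (i ∷ is) rewrite none i | ∧-zeroʳ (blk π i ≟ᶠ i) = go is

-- A labelled element shares its label with the least element of its block, which would then be
-- counted.
numLabelled≡0⇒unlabelled : {π : LP n} → Valid π → numLabelled π ≡ 0 → ∀ i → lab π i ≡ false
numLabelled≡0⇒unlabelled {n} {π} v eq i with lab π i in li
... | false = refl
... | true  = contradiction (subst (0 <_) eq positive-count) λ ()
  where
  positive-count : 0 < numLabelled π
  positive-count = ℕ.≤-<-trans z≤n (countᵇ-mono-< (λ _ → false) (λ i → (blk π i ≟ᶠ i) ∧ lab π i) (allFin n)
    (λ _ ()) (∈-allFin (blk π i)) refl
    (cong₂ _∧_ (dec-true (_ Fin.≟ _) (blk-blk v i)) (≡.trans (sym (lab-blk v i)) li)))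

hasLabelled-true : {π : LP n} → Valid π → hasLabelled π ≡ true → numLabelled π ≢ 0
hasLabelled-true {π = π} v h eq
  rewrite all-tabulate⁺ (not ∘ lab π) id (λ i → cong not (numLabelled≡0⇒unlabelled v eq i))
  = contradiction h λ ()

not-true : ∀ {b} → not b ≡ true → b ≡ false
not-true {false} _ = refl

hasLabelled-false : (π : LP n) → hasLabelled π ≡ false → ∀ i → lab π i ≡ false
hasLabelled-false π h i with all (not ∘ lab π) (allFin _) in eq
... | true = not-true (all-tabulate⁻ (not ∘ lab π) id eq i)

-- Together with transitivity it makes `ΠlX L` an upper set of `Πl n`, so above one of its members
-- both lists give the same sums.
hasLabelled-mono : {π σ : LP n} → Valid π → π ≼ σ → hasLabelled π ≡ true → hasLabelled σ ≡ true
hasLabelled-mono {π = π} {σ} v π≼σ h with hasLabelled σ in eq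
... | true  = refl
... | false = contradiction
  (unlabelled⇒numLabelled≡0 π λ i → contrapose (lab-mono π≼σ i) (hasLabelled-false σ eq i))
  (hasLabelled-true v h)
  where
  contrapose : ∀ {a b} → (a ≡ true → b ≡ true) → b ≡ false → a ≡ false
  contrapose {false} f _ = refl
  contrapose {true}  f b = ≡.trans (sym (f refl)) b

πX-valid : (L : Vec Bool n) → Valid (πX L)
πX-valid L = mkValid
  (λ i → ℕ.≤-reflexive (cong toℕ (blk-πX i)))
  (λ i → cong (blk (πX L)) (blk-πX i))
  (λ i → cong (lookup L) (sym (blk-πX i)))
  where
  blk-πX : ∀ i → blk (πX L) i ≡ i
  blk-πX = Vec.lookup∘tabulate id

countᵇ-cong : {p q : A → Bool} (xs : List A) → p ≗ q → countᵇ p xs ≡ countᵇ q xs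
countᵇ-cong []       eq = refl
countᵇ-cong {q = q} (x ∷ xs) eq rewrite eq x with q x
... | true  = cong suc (countᵇ-cong xs eq)
... | false = countᵇ-cong xs eq

countᵇ-lookup : (L : Vec Bool n) (f : Fin n → A) (p : A → Bool) → (∀ i → p (f i) ≡ lookup L i) →
                countᵇ p (tabulate f) ≡ numTrue L
countᵇ-lookup []      f p eq = refl
countᵇ-lookup (x ∷ L) f p eq rewrite eq zero with x
... | true  = cong suc (countᵇ-lookup L (f ∘ suc) p (eq ∘ suc))
... | false = countᵇ-lookup L (f ∘ suc) p (eq ∘ suc)

πX-test : (L : Vec Bool n) (q : Bool → Bool) (i : Fin n) →
          (blk (πX L) i ≟ᶠ i) ∧ q (lab (πX L) i) ≡ q (lookup L i)
πX-test L q i rewrite Vec.lookup∘tabulate id i | dec-true (i Fin.≟ i) refl = refl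

numLabelled-πX : (L : Vec Bool n) → numLabelled (πX L) ≡ numTrue L
numLabelled-πX L = countᵇ-lookup L id _ (πX-test L id)

numUnlabelled-πX : (L : Vec Bool n) → numUnlabelled (πX L) + numTrue L ≡ n
numUnlabelled-πX {n} L = begin
  numUnlabelled (πX L) + numTrue L
    ≡⟨ cong₂ _+_ (countᵇ-cong (allFin n) (πX-test L not)) (sym (countᵇ-lookup L id (lookup L) λ _ → refl)) ⟩
  countᵇ (not ∘ lookup L) (allFin n) + countᵇ (lookup L) (allFin n)
    ≡⟨ countᵇ-not (lookup L) (allFin n) ⟩
  length (allFin n)
    ≡⟨ length-tabulate id ⟩
  n ∎
  where open ≡-Reasoning

-- The values of λ and the count P₀

open module Inv {n : ℕ} = Inversion (Πl n) _≤LP_ _≡LP_ ≡LP⇒≡ ≡LP-refl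
  (λ σ → ≤LP⁺ σ σ (≼-refl σ))
  (λ {σ} {π} {ρ} p q → ≤LP⁺ σ ρ (≼-trans (≤LP⁻ σ π p) (≤LP⁻ π ρ q)))
  (λ {σ} {π} σ∈ π∈ p q → ≼-antisym (∈-Πl⁻ σ∈) (∈-Πl⁻ π∈) (≤LP⁻ σ π p) (≤LP⁻ π σ q))
  (Πl-unique n) using (möbius-inversion)

-- The hypothesis of Möbius inversion, with the claimed value of λ on the right. A labelled block
-- ensures that T is applied at least once.
mfun≡Σ : {π : LP n} → Valid π → hasLabelled π ≡ true →
         mfun π ≡ Σ (Πl n) (λ σ → if π ≤LP σ then lpWeight partitionMöbius σ else 0ℤ)
mfun≡Σ {n} {π} v h = sym (≡.trans (Σ-above v partitionMöbius) (go (numLabelled π) (hasLabelled-true v h)))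
  where
  go : ∀ t → t ≢ 0 → iterate F (iterate T partitionMöbius t) (numUnlabelled π) 0
                     ≡ (if does (t ℕ.≟ 1) then 1ℤ else 0ℤ)
  go zero          t≢0 = contradiction refl t≢0
  go (suc zero)    _   = FT-partitionMöbius (numUnlabelled π) 0
  go (suc (suc t)) _   = FT-partitionMöbius (numUnlabelled π) (suc t)

if-redundant : ∀ a b (x : ℤ) → (b ≡ true → a ≡ true) →
               (if a then (if b then x else 0ℤ) else 0ℤ) ≡ (if b then x else 0ℤ)
if-redundant true  b     x f = refl
if-redundant false true  x f = contradiction (f refl) λ ()
if-redundant false false x f = refl

module _ (L : Vec Bool n) where

  inΠlX : LP n → Bool
  inΠlX σ = (πX L ≤LP σ) ∧ hasLabelled σ

  ∈-ΠlX⁻ : {σ : LP n} → σ ∈ ΠlX L → σ ∈ Πl n × πX L ≼ σ × hasLabelled σ ≡ true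
  ∈-ΠlX⁻ {σ} σ∈ with σ∈Π , b ← ∈-filterᵇ⁻ inΠlX {xs = Πl n} σ∈
    with le , h ← ∧-true⁻ {πX L ≤LP σ} b = σ∈Π , ≤LP⁻ (πX L) σ le , h

  lambda≡ : {π : LP n} → π ∈ ΠlX L → lambda L π ≡ lpWeight partitionMöbius π
  lambda≡ {π} π∈ = begin
    lambda L π
      ≡⟨ Σ-filterᵇ (π ≤LP_) term (ΠlX L) ⟩
    Σ (ΠlX L) (λ σ → if π ≤LP σ then term σ else 0ℤ)
      ≡⟨ Σ-filterᵇ inΠlX _ (Πl n) ⟩
    Σ (Πl n) (λ σ → if inΠlX σ then (if π ≤LP σ then term σ else 0ℤ) else 0ℤ)
      ≡⟨ Σ-cong (Πl n) (λ {σ} _ → drop-test σ) ⟩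
    Σ (Πl n) (λ σ → if π ≤LP σ then term σ else 0ℤ)
      -- Inversion takes place in all of `Πl n`, but asks for the identity only above π, where a
      -- labelled block is always present.
      ≡⟨ möbius-inversion mfun (lpWeight partitionMöbius) π∈Π (λ {σ} σ∈ π≤σ →
           mfun≡Σ (∈-Πl⁻ σ∈) (hasLabelled-mono (∈-Πl⁻ π∈Π) (≤LP⁻ π σ π≤σ) h)) ⟩
    lpWeight partitionMöbius π ∎
    where
    open ≡-Reasoning
    π∈Π = proj₁ (∈-ΠlX⁻ π∈)
    πX≼π = proj₁ (proj₂ (∈-ΠlX⁻ π∈))
    h = proj₂ (proj₂ (∈-ΠlX⁻ π∈))
    term : LP n → ℤ
    term σ = μl π σ *ℤ mfun σ
    drop-test : ∀ σ → (if inΠlX σ then (if π ≤LP σ then term σ else 0ℤ) else 0ℤ)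
                    ≡ (if π ≤LP σ then term σ else 0ℤ)
    drop-test σ = if-redundant (inΠlX σ) (π ≤LP σ) (term σ) λ π≤σ → cong₂ _∧_
      (≤LP⁺ (πX L) σ (≼-trans πX≼π (≤LP⁻ π σ π≤σ)))
      (hasLabelled-mono (∈-Πl⁻ π∈Π) (≤LP⁻ π σ π≤σ) h)

  -- The indicator of λ ≠ 0 has the same shape as λ, with `positive` in place of `partitionMöbius`,
  -- so `Σ-above` applies again, now at `πX L`.
  P0≡ : P0 L ≡ iterate Fᴺ (iterate Tᴺ positive (numTrue L)) (numUnlabelled (πX L)) 0
  P0≡ = ℤ.+-injective (begin
    pos (P0 L)
      ≡⟨ pos-countᵇ nonzero (ΠlX L) ⟩
    Σ (ΠlX L) (λ π → if nonzero π then 1ℤ else 0ℤ)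
      ≡⟨ Σ-cong (ΠlX L) indicator ⟩
    Σ (ΠlX L) (lpWeight (pos ∘ positive))
      ≡⟨ Σ-filterᵇ inΠlX _ (Πl n) ⟩
    Σ (Πl n) (λ π → if inΠlX π then lpWeight (pos ∘ positive) π else 0ℤ)
      -- Partitions without a labelled block may be added, since `positive 0` gives them weight 0.
      ≡⟨ Σ-cong (Πl n) (λ {π} _ → drop-test π) ⟩
    Σ (Πl n) (λ π → if πX L ≤LP π then lpWeight (pos ∘ positive) π else 0ℤ)
      ≡⟨ Σ-above (πX-valid L) (pos ∘ positive) ⟩
    iterate F (iterate T (pos ∘ positive) (numLabelled (πX L))) (numUnlabelled (πX L)) 0
      ≡⟨ iterate-FT-pos (numUnlabelled (πX L)) (numLabelled (πX L)) positive ⟩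
    pos (iterate Fᴺ (iterate Tᴺ positive (numLabelled (πX L))) (numUnlabelled (πX L)) 0)
      ≡⟨ cong (λ t → pos (iterate Fᴺ (iterate Tᴺ positive t) (numUnlabelled (πX L)) 0)) (numLabelled-πX L) ⟩
    pos (iterate Fᴺ (iterate Tᴺ positive (numTrue L)) (numUnlabelled (πX L)) 0) ∎)
    where
    open ≡-Reasoning
    nonzero : LP n → Bool
    nonzero π = not (does (lambda L π ℤ.≟ 0ℤ))

    weight≢0 : ∀ a b → b ≢ 0 → (if not (does (weight partitionMöbius a b ℤ.≟ 0ℤ)) then 1ℤ else 0ℤ)
                             ≡ weight (pos ∘ positive) a b
    weight≢0 a zero b≢0 = contradiction refl b≢0
    weight≢0 zero          (suc b) _ rewrite dec-false (partitionMöbius (suc b) ℤ.≟ 0ℤ) (partitionMöbius≢0 b) = refl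
    weight≢0 (suc zero)    (suc b) _ rewrite dec-false (partitionMöbius (suc b) ℤ.≟ 0ℤ) (partitionMöbius≢0 b) = refl
    weight≢0 (suc (suc a)) (suc b) _ = refl

    indicator : ∀ {π} → π ∈ ΠlX L → (if nonzero π then 1ℤ else 0ℤ) ≡ lpWeight (pos ∘ positive) π
    indicator {π} π∈ = let π∈Π , _ , h = ∈-ΠlX⁻ π∈ in ≡.trans
      (cong (λ z → if not (does (z ℤ.≟ 0ℤ)) then 1ℤ else 0ℤ) (lambda≡ π∈))
      (weight≢0 (numUnlabelled π) (numLabelled π) (hasLabelled-true (∈-Πl⁻ π∈Π) h))

    weight-0 : ∀ a → weight (pos ∘ positive) a 0 ≡ 0ℤ
    weight-0 zero          = refl
    weight-0 (suc zero)    = refl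
    weight-0 (suc (suc a)) = refl

    drop-test : ∀ π → (if inΠlX π then lpWeight (pos ∘ positive) π else 0ℤ)
                    ≡ (if πX L ≤LP π then lpWeight (pos ∘ positive) π else 0ℤ)
    drop-test π with πX L ≤LP π
    ... | false = refl
    ... | true with hasLabelled π in h
    ...   | true  = refl
    ...   | false rewrite unlabelled⇒numLabelled≡0 π (hasLabelled-false π h) = sym (weight-0 (numUnlabelled π))

theorem6p12 : (n : ℕ) → 1 ≤ n → (k : ℕ) → k ≤ n →
    (L : Vec Bool n) → numTrue L ≡ k →
    (k ≡ 0 →
    (P0 L ≡ sumTo (n ∸ 1) (λ j → (n C j) * bell (n ∸ j)))
    × (sumTo (n ∸ 1) (λ j → (n C j) * bell (n ∸ j)) + 1 ≡ bell (suc n)))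
    × (1 ≤ k →
    P0 L ≡ sumTo (n ∸ k) (λ j → ((n ∸ k) C j) * bell (n ∸ j)))
theorem6p12 n@(suc m) _ k _ L refl = (λ k≡0 → none k≡0 , bell-minus-one) , some k refl
  where
  open ≡-Reasoning

  none : numTrue L ≡ 0 → P0 L ≡ sumTo m (λ j → (n C j) * bell (n ∸ j))
  none k≡0 = begin
    P0 L
      ≡⟨ P0≡ L ⟩
    iterate Fᴺ (iterate Tᴺ positive (numTrue L)) (numUnlabelled (πX L)) 0
      ≡⟨ cong₂ (λ t f → iterate Fᴺ (iterate Tᴺ positive t) f 0) k≡0 all-unlabelled ⟩
    iterate Fᴺ positive n 0
      ≡⟨ iterate-Fᴺ-positive m ⟩
    sumTo m (λ j → (n C j) * bell (n ∸ j)) ∎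
    where
    all-unlabelled : numUnlabelled (πX L) ≡ n
    all-unlabelled = ≡.trans (sym (ℕ.+-identityʳ _))
      (≡.trans (cong (numUnlabelled (πX L) +_) (sym k≡0)) (numUnlabelled-πX L))

  bell-minus-one : sumTo m (λ j → (n C j) * bell (n ∸ j)) + 1 ≡ bell (suc n)
  bell-minus-one = begin
    sumTo m (λ j → (n C j) * bell (n ∸ j)) + 1
      -- The 1 is the missing term j = n, namely C(n,n) B(0).
      ≡⟨ cong (sumTo m (λ j → (n C j) * bell (n ∸ j)) +_)
           (cong₂ _*_ (nCn≡1 n) (cong bell (ℕ.n∸n≡0 n))) ⟨
    sumTo n (λ j → (n C j) * bell (n ∸ j))
      ≡⟨ bell-suc n ⟨
    bell (suc n) ∎

  some : ∀ k → numTrue L ≡ k → 1 ≤ k → P0 L ≡ sumTo (n ∸ k) (λ j → ((n ∸ k) C j) * bell (n ∸ j))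
  some k@(suc t) eq _ = begin
    P0 L
      ≡⟨ P0≡ L ⟩
    iterate Fᴺ (iterate Tᴺ positive (numTrue L)) f 0
      ≡⟨ cong (λ t → iterate Fᴺ (iterate Tᴺ positive t) f 0) eq ⟩
    iterate Fᴺ (iterate Tᴺ positive k) f 0
      ≡⟨ iterate-FᴺTᴺ-positive f t ⟩
    sumTo f (λ j → (f C j) * bell ((k + f) ∸ j))
      ≡⟨ cong₂ (λ f n → sumTo f (λ j → (f C j) * bell (n ∸ j))) f≡n∸k k+f≡n ⟩
    sumTo (n ∸ k) (λ j → ((n ∸ k) C j) * bell (n ∸ j)) ∎
    where
    f : ℕ
    f = numUnlabelled (πX L)
    k+f≡n : k + f ≡ n
    k+f≡n = ≡.trans (ℕ.+-comm k f) (≡.trans (cong (f +_) (sym eq)) (numUnlabelled-πX L))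
    f≡n∸k : f ≡ n ∸ k
    f≡n∸k = ≡.trans (sym (ℕ.m+n∸m≡n k f)) (cong (_∸ k) k+f≡n)
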